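{- Even for binary input strings, the naïve LZD construction algorithm and the naïve LZMW construction algorithm each take $\Omega(n^{5/4}/\log^{1/4} n)$ time in the worst case; that is, for arbitrarily large $n$ there are binary strings of length $n$ on which the algorithm runs in time $\Omega(n^{5/4}/\log^{1/4} n)$.
   Context: LZD parsing of $s[1..n]$: $s=p_1\cdots p_z$, where with $k=|p_1\cdots p_{i-1}|+1$, $p_i=p_{i_1}p_{i_2}$ with $p_{i_1}$ the longest prefix of $s[k..n]$ in $\{p_1,\dots,p_{i-1}\}\cup\Sigma$ and $p_{i_2}$ the longest prefix of $s[k+|p_{i_1}|..n]$ in that set. LZMW parsing: $p_i$ is the longest prefix of $s[k..n]$ in $\{p_jp_{j+1}:1\le j\le i-2\}\cup\Sigma$. The naïve LZD algorithm maintains a compacted trie (edge labels stored as pairs of positions into the input) containing the phrases computed so far and the distinct letters seen so far, with these nodes marked. To find each component $p_{i_1}$ (resp. $p_{i_2}$) starting at position $j$, it traverses the trie from the root comparing letters of $s[j..n]$ with edge labels as far as the match extends, and takes the string of the lowest marked node on the matched path (a first occurrence of a letter is inserted as a new marked child of the root). After computing $p_i$ it inserts $p_i$ into the trie by a root-to-node traversal, creating at most two nodes and marking the node of $p_i$. The naïve LZMW algorithm is identical except that the trie contains (marked) the strings $p_1p_2,\dots,p_{i-2}p_{i-1}$ and the letters, and one longest marked match is taken per phrase. Running time counts all letter comparisons and trie-edge traversals. -}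

module Defs where

open import Data.Bool using (Bool; true; false; _∧_; if_then_else_)
open import Data.Bool.Properties using () renaming (_≟_ to _≟ᵇ_)
open import Data.Nat using (ℕ; zero; suc; _+_; _⊔_; _≤ᵇ_)
open import Data.List using (List; []; _∷_; _++_; length; drop; map)
open import Data.Maybe using (Maybe; just; nothing)
open import Data.Product using (_×_; _,_)
open import Relation.Nullary.Decidable using (⌊_⌋)

BStr : Set
BStr = List Bool

Σ-letters : List BStr
Σ-letters = (false ∷ []) ∷ (true ∷ []) ∷ []

isPrefix : BStr → BStr → Bool
isPrefix [] w = true
isPrefix (a ∷ u) [] = false
isPrefix (a ∷ u) (b ∷ w) = ⌊ a ≟ᵇ b ⌋ ∧ isPrefix u w

lcp : BStr → BStr → ℕ
lcp [] _ = 0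
lcp (a ∷ u) [] = 0
lcp (a ∷ u) (b ∷ w) = if ⌊ a ≟ᵇ b ⌋ then suc (lcp u w) else 0

longestPrefixIn : List BStr → BStr → BStr
longestPrefixIn [] w = []
longestPrefixIn (d ∷ D) w with longestPrefixIn D w
... | best = if isPrefix d w ∧ (suc (length best) ≤ᵇ length d) then d else best

-- Number of letters of w matched when traversing, from the root, a trie
-- whose strings are T: the length of the longest prefix of w spelled by a
-- root path, i.e. max over t ∈ T of lcp t w.  Each matched letter costs
-- (at least) one letter comparison in the naive traversal.
trieMatch : List BStr → BStr → ℕ
trieMatch [] w = 0
trieMatch (t ∷ T) w = lcp t w ⊔ trieMatch T w

seenLetters : BStr → List BStr
seenLetters done = map (λ a → a ∷ []) done

-- Naive LZD.  State: fuel, phrases computed so far D, processed prefix,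
-- remaining suffix.  Returns the total number of letter comparisons
-- performed by the component searches (matched letters).
-- The trie holds the phrases p_1..p_{i-1} and the letters seen so far.

lzdLoop : ℕ → List BStr → BStr → BStr → ℕ
lzdLoop zero D done w = 0
lzdLoop (suc f) D done [] = 0
lzdLoop (suc f) D done (a ∷ w₀) =
  let w    = a ∷ w₀
      c₁   = longestPrefixIn (D ++ Σ-letters) w
      k₁   = trieMatch (D ++ seenLetters done) w
      w'   = drop (length c₁) w
      done' = done ++ c₁
      c₂   = longestPrefixIn (D ++ Σ-letters) w'
      k₂   = trieMatch (D ++ seenLetters done') w'
  in k₁ + k₂ + lzdLoop f ((c₁ ++ c₂) ∷ D) (done' ++ c₂) (drop (length c₂) w')

lzdTime : BStr → ℕ
lzdTime s = lzdLoop (length s) [] [] s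

-- Naive LZMW.  State: fuel, the inserted strings p_j p_{j+1} (j ≤ i-2),
-- the previous phrase p_{i-1} (if any), processed prefix, remaining suffix.

lzmwLoop : ℕ → List BStr → Maybe BStr → BStr → BStr → ℕ
lzmwLoop zero P prev done w = 0
lzmwLoop (suc f) P prev done [] = 0
lzmwLoop (suc f) P prev done (a ∷ w₀) =
  let w  = a ∷ w₀
      p  = longestPrefixIn (P ++ Σ-letters) w
      k  = trieMatch (P ++ seenLetters done) w
      P' = insertPair prev p
  in k + lzmwLoop f P' (just p) (done ++ p) (drop (length p) w)
  where
  insertPair : Maybe BStr → BStr → List BStr
  insertPair nothing  p = P
  insertPair (just q) p = (q ++ p) ∷ P

lzmwTime : BStr → ℕ
lzmwTime s = lzmwLoop (length s) [] nothing [] s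

-- T(s) = Ω(n^{5/4} / log^{1/4} n) along arbitrarily large n, with an
-- explicit constant: n^5 ≤ c · T(s)^4 · ⌊log₂ n⌋.

{-# OPTIONS --safe #-}

-- A prefix of the input makes tokens 0, 1, …, 25K² − 1, coded by words aⁱ b aʲ b (LZD) or
-- aⁱ b a aʲ b a (LZMW) of length Θ(K), into dictionary words.  The tokens below K·k, with
-- k = 3K + 2, form K blocks of k tokens.  For every block start o the dictionary receives the
-- deep string of all tokens from o to K·k inclusive, built as token o followed by the rest, so
-- that it has no long marked proper prefix.  In each of K rounds the text 0 1 … (K·k − 1) is
-- read: at every block start the search descends through the deep string up to the end of the
-- text but returns a phrase inside the block, as the last token is missing.  A phrase of length
-- y at the block start is followed by a one-token phrase, so that the round lengthens the longest
-- mark there by one; two further insertions move the next round to fresh positions of the block.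
-- The remaining tokens serve as separators, each read once.  The input has O(K³) tokens, hence
-- length O(K⁴), while the K rounds of K searches, each over Θ(K²) tokens on average, cost Ω(K⁵).
module Submission where

open import Defs
open import Data.Bool using (T; true; false)
open import Data.Bool.Properties using () renaming (_≟_ to _≟ᵇ_)
open import Data.Empty using (⊥; ⊥-elim)
open import Data.List using (List; []; _∷_; _++_; length; drop)
open import Data.List.Properties using (++-assoc; ++-identityʳ; length-++; ∷-injectiveʳ; ∷-injectiveˡ; ++-cancelˡ)
open import Data.List.Membership.Propositional using (_∈_)
open import Data.List.Membership.Propositional.Properties using (∈-++⁺ˡ; ∈-++⁺ʳ; ∈-++⁻)
open import Data.List.Relation.Unary.All as All using (All; []; _∷_)
open import Data.List.Relation.Unary.All.Properties using () renaming (++⁺ to All-++⁺)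
open import Data.List.Relation.Unary.Any using (Any; here; there)
open import Data.List.Relation.Unary.Any.Properties using () renaming (++⁺ʳ to Any-++⁺ʳ; ++⁺ˡ to Any-++⁺ˡ)
open import Data.Maybe using (just)
open import Data.Nat
open import Data.Nat.DivMod
open import Data.Nat.Divisibility using (n∣m*n)
open import Data.Nat.Logarithm using (⌊log₂_⌋; ⌊log₂⌋-mono-≤)
open import Data.Nat.Properties
open import Data.Nat.Tactic.RingSolver using (solve-∀)
open import Data.Product using (_×_; _,_; proj₁; proj₂; ∃-syntax)
open import Data.Sum using (_⊎_; inj₁; inj₂)
open import Function using (_∘_)
open import Relation.Binary.PropositionalEquality
open import Relation.Binary.Definitions using (tri<; tri≈; tri>)
open import Relation.Nullary using (yes; no; contradiction)

-- A search is costly for little progress when its trie path is long but almost unmarked. The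
-- obstacle is that every reading creates marks, and a mark that grows too far at a position would
-- swallow the next reading there. So, apart from block starts, no position begins a phrase in two
-- rounds' passes over the text: each round spends three positions, which together with offsets 0
-- and 1 gives `k = 3K + 2`. One text serves both algorithms because they cut it into the same pairs
-- of phrases. The further marks of LZMW begin where the second phrase of a pair began. They are
-- only bounded from above, and only at positions still to be read, while the marks that must be
-- present are tracked separately; the dictionary is never determined exactly. A token is a pair of
-- exponents so that words of length O(K) name order K² tokens, enough for every insertion to be
-- closed by two separators of its own.

pattern a = false
pattern b = true

-- Longest dictionary prefixes and trie matches

Pre : BStr → BStr → Set
Pre d w = ∃[ z ] d ++ z ≡ w

isPrefix-sound : ∀ d w → isPrefix d w ≡ true → Pre d w
isPrefix-sound [] w _ = w , refl
isPrefix-sound (x ∷ d) (y ∷ w) eq with x ≟ᵇ y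
... | yes refl = let z , e = isPrefix-sound d w eq in z , cong (x ∷_) e

isPrefix-++ : ∀ d z → isPrefix d (d ++ z) ≡ true
isPrefix-++ [] z = refl
isPrefix-++ (x ∷ d) z with x ≟ᵇ x
... | yes _ = isPrefix-++ d z
... | no x≢x = contradiction refl x≢x

≤ᵇ-true : ∀ {m n} → m ≤ n → (m ≤ᵇ n) ≡ true
≤ᵇ-true {m} {n} m≤n with m ≤ᵇ n | ≤⇒≤ᵇ m≤n
... | true | _ = refl

lpi-Pre : ∀ L w → Pre (longestPrefixIn L w) w
lpi-Pre [] w = w , refl
lpi-Pre (d ∷ L) w with isPrefix d w in eq | suc (length (longestPrefixIn L w)) ≤ᵇ length d
... | false | _     = lpi-Pre L w
... | true  | false = lpi-Pre L w
... | true  | true  = isPrefix-sound d w eq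

lpi-max : ∀ {d} L w → d ∈ L → Pre d w → length d ≤ length (longestPrefixIn L w)
lpi-max (d ∷ L) _ (here refl) (z , refl)
  rewrite isPrefix-++ d z
  with suc (length (longestPrefixIn L (d ++ z))) ≤ᵇ length d in eq
... | true  = ≤-refl
... | false = ≮⇒≥ λ lt → contradiction (trans (sym eq) (≤ᵇ-true lt)) λ ()
lpi-max (d ∷ L) w (there d∈) pre
  with isPrefix d w | suc (length (longestPrefixIn L w)) ≤ᵇ length d in eq
... | false | _     = lpi-max L w d∈ pre
... | true  | false = lpi-max L w d∈ pre
... | true  | true  = ≤-trans (lpi-max L w d∈ pre)
                        (<⇒≤ (≤ᵇ⇒≤ _ _ (subst T (sym eq) _)))

lpi-∈ : ∀ L w → longestPrefixIn L w ≡ [] ⊎ longestPrefixIn L w ∈ L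
lpi-∈ [] w = inj₁ refl
lpi-∈ (d ∷ L) w with isPrefix d w | suc (length (longestPrefixIn L w)) ≤ᵇ length d | lpi-∈ L w
... | false | _     | inj₁ e = inj₁ e
... | false | _     | inj₂ m = inj₂ (there m)
... | true  | false | inj₁ e = inj₁ e
... | true  | false | inj₂ m = inj₂ (there m)
... | true  | true  | _      = inj₂ (here refl)

Pre-unique : ∀ c d {w} → Pre c w → Pre d w → length c ≡ length d → c ≡ d
Pre-unique [] [] _ _ _ = refl
Pre-unique (x ∷ c) (y ∷ d) (_ , refl) (z , e) eq =
  cong₂ _∷_ (sym (∷-injectiveˡ e)) (Pre-unique c d (_ , refl) (z , ∷-injectiveʳ e) (suc-injective eq))

record Longest (L : List BStr) (c w : BStr) : Set where
  constructor longest
  field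
    member  : c ∈ L
    prefix  : Pre c w
    maximal : ∀ {d} → d ∈ L → Pre d w → length d ≤ length c

-- Prefixes of one word are determined by their length, so ties in `longestPrefixIn` are harmless
-- and every search can be specified by `Longest` alone.
lpi-unique : ∀ {L c w} → Longest L c w → longestPrefixIn L w ≡ c
lpi-unique {L} {c} {w} (longest c∈ pre max) =
  Pre-unique _ c (lpi-Pre L w) pre (≤-antisym upper (lpi-max L w c∈ pre))
  where
  upper : length (longestPrefixIn L w) ≤ length c
  upper with lpi-∈ L w
  ... | inj₁ e rewrite e = z≤n
  ... | inj₂ m = max m (lpi-Pre L w)

lcp≤trieMatch : ∀ {x} L w → x ∈ L → lcp x w ≤ trieMatch L w
lcp≤trieMatch (t ∷ L) w (here refl) = m≤m⊔n _ _
lcp≤trieMatch (t ∷ L) w (there x∈)  = ≤-trans (lcp≤trieMatch L w x∈) (m≤n⊔m _ _)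

trieMatch-++ : ∀ L L′ w → trieMatch L w ≤ trieMatch (L ++ L′) w
trieMatch-++ [] L′ w = z≤n
trieMatch-++ (t ∷ L) L′ w = ⊔-monoʳ-≤ (lcp t w) (trieMatch-++ L L′ w)

length≤lcp : ∀ u {y z} → length u ≤ lcp (u ++ y) (u ++ z)
length≤lcp [] = z≤n
length≤lcp (x ∷ u) with x ≟ᵇ x
... | yes _ = s≤s (length≤lcp u)
... | no x≢x = contradiction refl x≢x

drop-++ : ∀ (c w : BStr) → drop (length c) (c ++ w) ≡ w
drop-++ [] w = refl
drop-++ (_ ∷ c) w = drop-++ c w

-- A common interface to LZD and LZMW

-- Both algorithms read phrases in pairs c₁ c₂ and insert c₁ c₂.  LZMW moreover inserts the pair
-- formed by the previous phrase and c₁, recorded in extra; tail is what this adds to the marks aⁱ b.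
-- Slow D prev w τ: with dictionary D and previous phrase prev, reading w costs at least τ.
record Algorithm : Set₁ where
  field
    time  : BStr → ℕ
    Slow  : List BStr → BStr → BStr → ℕ → Set
    extra : BStr → BStr → List BStr
    tail  : BStr
    extra-∈ : ∀ {prev c d} → d ∈ extra prev c → d ≡ prev ++ c × tail ≡ a ∷ []
    tail-∈  : ∀ {prev D} → prev ∈ D → prev ++ tail ∈ extra prev (a ∷ []) ++ D
    tail-≤  : length tail ≤ 1
    start : ∀ {w τ} → Slow ((a ∷ b ∷ []) ∷ []) (b ∷ []) w τ → τ ≤ time (a ∷ b ∷ w)
    stop  : ∀ {D prev w} → Slow D prev w 0
    step  : ∀ {D prev c₁ c₂ rest w g τ} → 1 ≤ length c₁ → 1 ≤ length c₂ → w ≡ c₁ ++ c₂ ++ rest →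
            Longest (D ++ Σ-letters) c₁ w →
            Longest ((extra prev c₁ ++ D) ++ Σ-letters) c₂ (c₂ ++ rest) →
            g ≤ trieMatch D w →
            Slow ((c₁ ++ c₂) ∷ extra prev c₁ ++ D) c₂ rest τ →
            Slow D prev w (g + τ)

-- One loop iteration reads a whole pair without inserting anything in between, so `extra` is empty.
-- `start` is the first iteration: on `a b` both components are letters, and `ab` becomes the only
-- mark.
lzd : Algorithm
lzd = record
  { time = lzdTime ; Slow = Slow ; extra = λ _ _ → [] ; tail = []
  ; extra-∈ = λ () ; tail-∈ = λ {prev} {D} → subst (_∈ D) (sym (++-identityʳ prev)) ; tail-≤ = z≤n
  ; start = λ slow → slow _ _ (n≤1+n _) ; stop = λ _ _ _ → z≤n ; step = λ {D} {prev} → step {D} {prev} }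
  where
  Slow : List BStr → BStr → BStr → ℕ → Set
  Slow D prev w τ = ∀ f done → length w ≤ f → τ ≤ lzdLoop f D done w

  step : ∀ {D prev c₁ c₂ rest w g τ} → 1 ≤ length c₁ → 1 ≤ length c₂ → w ≡ c₁ ++ c₂ ++ rest →
         Longest (D ++ Σ-letters) c₁ w → Longest (D ++ Σ-letters) c₂ (c₂ ++ rest) →
         g ≤ trieMatch D w → Slow ((c₁ ++ c₂) ∷ D) c₂ rest τ → Slow D prev w (g + τ)
  step {D} {prev} {x ∷ c₁} {c₂} {rest} _ _ refl l₁ l₂ g≤ slow (suc f) done (s≤s len)
    rewrite lpi-unique l₁ | drop-++ c₁ (c₂ ++ rest) | lpi-unique l₂ | drop-++ c₂ rest =
    +-mono-≤ (≤-trans g≤ (≤-trans (trieMatch-++ D _ _) (m≤m+n _ _)))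
      (slow f _ (≤-trans (m≤n+m _ (length c₂))
        (≤-trans (≤-reflexive (sym (length-++ c₂)))
          (≤-trans (m≤n+m _ (length c₁)) (≤-trans (≤-reflexive (sym (length-++ c₁))) len)))))

-- A pair takes two iterations, and `prev ++ c₁` enters the dictionary before `c₂` is sought; hence
-- the enlarged dictionary in the second `Longest` of `step`. Only comparisons of the first search
-- are credited to `g`.
lzmw : Algorithm
lzmw = record
  { time = lzmwTime ; Slow = Slow ; extra = λ prev c → (prev ++ c) ∷ [] ; tail = a ∷ []
  ; extra-∈ = λ { (here refl) → refl , refl } ; tail-∈ = λ _ → here refl ; tail-≤ = ≤-refl
  ; start = λ slow → slow _ _ ≤-refl ; stop = λ _ _ _ → z≤n ; step = step }
  where
  Slow : List BStr → BStr → BStr → ℕ → Set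
  Slow D prev w τ = ∀ f done → length w ≤ f → τ ≤ lzmwLoop f D (just prev) done w

  step : ∀ {D prev c₁ c₂ rest w g τ} → 1 ≤ length c₁ → 1 ≤ length c₂ → w ≡ c₁ ++ c₂ ++ rest →
         Longest (D ++ Σ-letters) c₁ w → Longest (((prev ++ c₁) ∷ D) ++ Σ-letters) c₂ (c₂ ++ rest) →
         g ≤ trieMatch D w → Slow ((c₁ ++ c₂) ∷ (prev ++ c₁) ∷ D) c₂ rest τ → Slow D prev w (g + τ)
  step {D} {prev} {x ∷ c₁} {y ∷ c₂} {rest} {τ = τ} _ _ refl l₁ l₂ g≤ slow (suc f) done (s≤s len)
    rewrite lpi-unique l₁ | drop-++ c₁ (y ∷ c₂ ++ rest) =
    +-mono-≤ (≤-trans g≤ (trieMatch-++ D _ _))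
      (second f (≤-trans (m≤n+m _ (length c₁)) (≤-trans (≤-reflexive (sym (length-++ c₁))) len)))
    where
    second : ∀ f → suc (length (c₂ ++ rest)) ≤ f →
             τ ≤ lzmwLoop f ((prev ++ x ∷ c₁) ∷ D) (just (x ∷ c₁)) (done ++ x ∷ c₁) (y ∷ c₂ ++ rest)
    second (suc f) (s≤s len′) rewrite lpi-unique l₂ | drop-++ c₂ rest =
      ≤-trans (slow f _ (≤-trans (m≤n+m _ (length c₂)) (≤-trans (≤-reflexive (sym (length-++ c₂))) len′)))
              (m≤n+m _ _)

-- Words aⁱ b v

run : ℕ → BStr → BStr
run zero    v = b ∷ v
run (suc i) v = a ∷ run i v

run-++ : ∀ i v z → run i v ++ z ≡ run i (v ++ z)
run-++ zero    v z = refl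
run-++ (suc i) v z = cong (a ∷_) (run-++ i v z)

run-injective : ∀ i j {v w} → run i v ≡ run j w → i ≡ j × v ≡ w
run-injective zero    zero    refl = refl , refl
run-injective (suc i) (suc j) eq with refl , e ← run-injective i j (∷-injectiveʳ eq) = refl , e

length-run : ∀ i v → length (run i v) ≡ suc (i + length v)
length-run zero    v = refl
length-run (suc i) v = cong suc (length-run i v)

letter-length : ∀ {d} → d ∈ Σ-letters → length d ≡ 1
letter-length (here refl)         = refl
letter-length (there (here refl)) = refl

longest-among : ∀ {D c z w} → 1 ≤ length c → c ∈ D ++ Σ-letters → w ≡ c ++ z →
                (∀ {d} → d ∈ D → Pre d w → length d ≤ length c) → Longest (D ++ Σ-letters) c w
longest-among {D} 1≤c c∈ w≡ max = longest c∈ (_ , sym w≡) λ d∈ pre → case (∈-++⁻ D d∈) pre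
  where
  case : ∀ {d} → d ∈ D ⊎ d ∈ Σ-letters → Pre d _ → length d ≤ _
  case (inj₁ d∈) pre = max d∈ pre
  case (inj₂ d∈) _   = ≤-trans (≤-reflexive (letter-length d∈)) 1≤c

-- Turning tokens into dictionary words

module Codes (alg : Algorithm) (H : ℕ) .{{_ : NonZero H}} where
  open Algorithm alg

  -- In LZMW `aⁱ b a` becomes marked along with `aⁱ b`, and units follow one another, each starting
  -- with `a`: a unit without the final `a` would be read one letter too far.
  unit : ℕ → BStr
  unit i = run i tail

  unit-cancel : ∀ i j {y z} → unit i ++ y ≡ unit j ++ z → i ≡ j × y ≡ z
  unit-cancel i j {y} {z} eq
    with refl , e ← run-injective i j (trans (sym (run-++ i tail y)) (trans eq (run-++ j tail z)))
    = refl , ++-cancelˡ tail y z e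

  unit-nonempty : ∀ i → 1 ≤ length (unit i)
  unit-nonempty i = ≤-trans (s≤s z≤n) (≤-reflexive (sym (length-run i tail)))

  length-unit : ∀ i → length (unit i) ≤ 2 + i
  length-unit i = begin
    length (unit i)         ≡⟨ length-run i tail ⟩
    suc (i + length tail)   ≤⟨ s≤s (+-monoʳ-≤ i tail-≤) ⟩
    suc (i + 1)             ≡⟨ cong suc (+-comm i 1) ⟩
    2 + i                   ∎
    where open ≤-Reasoning

  chainText : ℕ → ℕ → BStr
  chainText i zero    = []
  chainText i (suc j) = run (2 + i) [] ++ chainText (suc i) j

  length-chainText : ∀ i j → length (chainText i j) ≤ j * (2 + (i + j))
  length-chainText i zero    = z≤n
  length-chainText i (suc j) = begin
    length (run (2 + i) [] ++ chainText (suc i) j)        ≡⟨ length-++ (run (2 + i) []) ⟩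
    length (run (2 + i) []) + length (chainText (suc i) j) ≤⟨ +-mono-≤ run-≤ (length-chainText (suc i) j) ⟩
    (2 + (i + suc j)) + j * (2 + (suc i + j))              ≡⟨ cong (λ x → (2 + (i + suc j)) + j * (2 + x)) (sym (+-suc i j)) ⟩
    suc j * (2 + (i + suc j))                              ∎
    where
    open ≤-Reasoning
    run-≤ : length (run (2 + i) []) ≤ 2 + (i + suc j)
    run-≤ = ≤-trans (≤-reflexive (trans (length-run (2 + i) []) (cong (3 +_) (+-identityʳ i))))
                    (s≤s (s≤s (≤-trans (s≤s (m≤m+n i j)) (≤-reflexive (sym (+-suc i j))))))

  -- The second alternative holds the marks peculiar to LZMW: the previous phrase `aʲ b` followed by
  -- the letter `a`.
  ChainMark : ℕ → BStr → Set
  ChainMark i d = (∃[ j ] j ≤ suc i × d ≡ run j []) ⊎ (tail ≡ a ∷ [] × ∃[ j ] j < i × d ≡ run j (a ∷ []))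

  record Chain (i : ℕ) (D : List BStr) : Set where
    field
      marks : ∀ {d} → d ∈ D → ChainMark i d
      runs  : ∀ {j} → 1 ≤ j → j ≤ suc i → run j [] ∈ D
      units : ∀ {j} → 1 ≤ j → j < i → unit j ∈ D

  -- Every mark has its first `b` after at most `i + 1` letters `a`, whereas the text starts with
  -- `i + 2` of them. So the first phrase is the letter `a` and the second the longest word of the
  -- chain so far; their product is the next word.
  chain-step : ∀ {i D w τ} → Chain i D →
               (∀ {D′} → Chain (suc i) D′ → Slow D′ (run (suc i) []) w τ) →
               Slow D (run i []) (run (2 + i) [] ++ w) τ
  chain-step {i} {D} {w} ch k =
    step {c₁ = a ∷ []} {c₂ = run (suc i) []} {rest = w} {g = 0} ≤-refl (s≤s z≤n) refl
      (longest-among ≤-refl (∈-++⁺ʳ D (here refl)) refl max₁)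
      (longest-among (s≤s z≤n) (∈-++⁺ˡ (∈-++⁺ʳ (extra (run i []) (a ∷ [])) (runs (s≤s z≤n) ≤-refl))) refl
        (λ d∈ → max₂ (∈-++⁻ (extra (run i []) (a ∷ [])) d∈)))
      z≤n
      (k record { marks = marks′ ; runs = runs′ ; units = units′ })
    where
    open Chain ch
    bound : ∀ {d j v} → Pre (run j v) (run (2 + i) [] ++ w) → j ≤ suc i → d ≤ 1
    bound {j = j} (z , e) j≤ with refl , _ ← run-injective j (2 + i) (trans (sym (run-++ j _ z)) (trans e (run-++ (2 + i) [] w))) =
      contradiction j≤ 1+n≰n
    max₁ : ∀ {d} → d ∈ D → Pre d (run (2 + i) [] ++ w) → length d ≤ 1
    max₁ d∈ pre with marks d∈
    ... | inj₁ (j , j≤ , refl)     = bound pre j≤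
    ... | inj₂ (_ , j , j< , refl) = bound pre (≤-trans (<⇒≤ j<) (n≤1+n i))
    max₂ : ∀ {d} → d ∈ extra (run i []) (a ∷ []) ⊎ d ∈ D → Pre d (run (suc i) [] ++ w) → length d ≤ length (run (suc i) [])
    same : ∀ {j v} → Pre (run j v) (run (suc i) [] ++ w) → j ≡ suc i
    same {j} (z , e) = proj₁ (run-injective j (suc i) (trans (sym (run-++ j _ z)) (trans e (run-++ (suc i) [] w))))
    max₂ (inj₁ d∈) pre with refl , _ ← extra-∈ d∈ =
      contradiction (same (subst (λ x → Pre x (run (suc i) [] ++ w)) (run-++ i [] (a ∷ [])) pre)) (<⇒≢ ≤-refl)
    max₂ (inj₂ d∈) pre with marks d∈
    ... | inj₁ (j , j≤ , refl) with refl ← same {j} pre = ≤-refl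
    ... | inj₂ (_ , j , j< , refl) = contradiction (same pre) (<⇒≢ (≤-trans j< (n≤1+n i)))
    marks′ : ∀ {d} → d ∈ run (2 + i) [] ∷ extra (run i []) (a ∷ []) ++ D → ChainMark (suc i) d
    marks′ (here refl) = inj₁ (_ , ≤-refl , refl)
    marks′ (there d∈) with ∈-++⁻ (extra (run i []) (a ∷ [])) d∈
    ... | inj₁ d∈ with refl , t≡ ← extra-∈ d∈ = inj₂ (t≡ , i , ≤-refl , run-++ i [] (a ∷ []))
    ... | inj₂ d∈ with marks d∈
    ...   | inj₁ (j , j≤ , e)      = inj₁ (j , ≤-trans j≤ (n≤1+n _) , e)
    ...   | inj₂ (t≡ , j , j< , e) = inj₂ (t≡ , j , ≤-trans j< (n≤1+n _) , e)
    runs′ : ∀ {j} → 1 ≤ j → j ≤ 2 + i → run j [] ∈ run (2 + i) [] ∷ extra (run i []) (a ∷ []) ++ D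
    runs′ {j} 1≤j j≤ with m≤n⇒m<n∨m≡n j≤
    ... | inj₁ (s≤s j<) = there (∈-++⁺ʳ _ (runs 1≤j j<))
    ... | inj₂ refl     = here refl
    units′ : ∀ {j} → 1 ≤ j → j < suc i → unit j ∈ run (2 + i) [] ∷ extra (run i []) (a ∷ []) ++ D
    units′ {j} 1≤j (s≤s j≤) with m≤n⇒m<n∨m≡n j≤
    ... | inj₁ j<   = there (∈-++⁺ʳ _ (units 1≤j j<))
    -- For LZD the unit is the run itself, already marked; for LZMW it is the product of the
    -- previous phrase and `a`, inserted just now.
    ... | inj₂ refl = there (subst (_∈ extra (run i []) (a ∷ []) ++ D) (run-++ i [] tail) (tail-∈ (runs 1≤j (n≤1+n i))))

  chain : ∀ {w τ} j {i D} → Chain i D →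
          (∀ {D′} → Chain (i + j) D′ → Slow D′ (run (i + j) []) w τ) →
          Slow D (run i []) (chainText i j ++ w) τ
  chain zero {i} {D} ch k = subst (λ x → Slow D (run x []) _ _) (+-identityʳ i)
    (k (subst (λ x → Chain x D) (sym (+-identityʳ i)) ch))
  chain {w} {τ} (suc j) {i} {D} ch k =
    subst (λ x → Slow D (run i []) x τ) (sym (++-assoc (run (2 + i) []) (chainText (suc i) j) w))
      (chain-step ch λ ch′ → chain j ch′ λ {D′} ch″ →
        subst (λ x → Slow D′ (run x []) w τ) (+-suc i j) (k (subst (λ x → Chain x D′) (sym (+-suc i j)) ch″)))

  -- Quotient and remainder of `t` by `H`, shifted into the disjoint ranges up to `H + 1` (for
  -- `t ≤ M`) and from `H + 2` to `2H + 1`, so that an exponent reveals its place within a code. `Z`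
  -- lies beyond both ranges.
  p q : ℕ → ℕ
  p t = suc (t / H)
  q t = 2 + (H + t % H)

  M Z : ℕ
  M = H * H
  Z = 2 + (H + H)

  code : ℕ → BStr
  code t = unit (p t) ++ unit (q t)

  p≤ : ∀ {t} → t ≤ M → p t ≤ suc H
  p≤ {t} t≤ = s≤s (≤-trans (/-monoˡ-≤ H t≤) (≤-reflexive (m*n/n≡m H H)))

  q<Z : ∀ t → q t < Z
  q<Z t = s≤s (s≤s (≤-trans (≤-reflexive (sym (+-suc H _))) (+-monoʳ-≤ H (m%n<n t H))))

  H<q : ∀ t → suc H < q t
  H<q t = s≤s (s≤s (m≤m+n H _))

  p≢q : ∀ {s t} → s ≤ M → p s ≢ q t
  p≢q {s} {t} s≤ = <⇒≢ (≤-<-trans (p≤ s≤) (H<q t))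

  p≢Z : ∀ {s} → s ≤ M → p s ≢ Z
  p≢Z s≤ = <⇒≢ (≤-<-trans (p≤ s≤) (s≤s (s≤s (m≤m+n H H))))

  divMod-injective : ∀ {s t} → s % H ≡ t % H → s / H ≡ t / H → s ≡ t
  divMod-injective {s} {t} e₁ e₂ = begin
    s                       ≡⟨ m≡m%n+[m/n]*n s H ⟩
    s % H + (s / H) * H     ≡⟨ cong₂ (λ x y → x + y * H) e₁ e₂ ⟩
    t % H + (t / H) * H     ≡⟨ m≡m%n+[m/n]*n t H ⟨
    t                       ∎
    where open ≡-Reasoning

  q-injective : ∀ {s t} → q s ≡ q t → s % H ≡ t % H
  q-injective e = +-cancelˡ-≡ H _ _ (suc-injective (suc-injective e))

  pq-injective : ∀ {s t} → p s ≡ p t → q s ≡ q t → s ≡ t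
  pq-injective e₁ e₂ = divMod-injective (q-injective e₂) (suc-injective e₁)

  -- The residue of `s` fixes that of `s + 1`, so both residue and quotient of `s + 1` are known.
  -- Hence the LZMW marks that straddle two consecutive codes are pairwise distinct, and none of
  -- them matches at a later boundary.
  qp-injective : ∀ {s t} → q s ≡ q t → p (suc s) ≡ p (suc t) → s ≡ t
  qp-injective {s} {t} e₁ e₂ = suc-injective (divMod-injective shifted (suc-injective e₂))
    where
    shifted : suc s % H ≡ suc t % H
    shifted = trans (%-distribˡ-+ 1 s H)
      (trans (cong (λ x → (1 % H + x) % H) (q-injective e₁)) (sym (%-distribˡ-+ 1 t H)))

  units-cancel : ∀ i j x y {z w} → (unit i ++ unit j) ++ z ≡ unit x ++ unit y ++ w → i ≡ x × j ≡ y × z ≡ w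
  units-cancel i j x y {z} eq
    with refl , e ← unit-cancel i x (trans (sym (++-assoc (unit i) (unit j) z)) eq)
    with refl , e′ ← unit-cancel j y e = refl , refl , e′

  code-cancel : ∀ s t {y z} → code s ++ y ≡ code t ++ z → s ≡ t × y ≡ z
  code-cancel s t {y} {z} eq
    with e₁ , e₂ , e ← units-cancel (p s) (q s) (p t) (q t) (trans eq (++-assoc (unit (p t)) (unit (q t)) z))
    = pq-injective e₁ e₂ , e

  ShortU : BStr → Set
  ShortU d = ∀ {i z} → i ≤ Z → Pre d (unit i ++ z) → length d ≤ length (unit i)

  PairMark : ℕ → BStr → Set
  PairMark t d = ShortU d ⊎ (∃[ s ] s < t × d ≡ code s) ⊎ (∃[ s ] s < t × d ≡ unit (q s) ++ unit (p (suc s)))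

  PairMark-suc : ∀ {t d} → PairMark t d → PairMark (suc t) d
  PairMark-suc (inj₁ short)                 = inj₁ short
  PairMark-suc (inj₂ (inj₁ (s , s<t , e)))  = inj₂ (inj₁ (s , m<n⇒m<1+n s<t , e))
  PairMark-suc (inj₂ (inj₂ (s , s<t , e)))  = inj₂ (inj₂ (s , m<n⇒m<1+n s<t , e))

  record Pairs (t : ℕ) (D : List BStr) (prev : BStr) : Set where
    field
      marks    : ∀ {d} → d ∈ D → PairMark t d
      units    : ∀ {i} → 1 ≤ i → i ≤ Z → unit i ∈ D
      codes    : ∀ {s} → s < t → code s ∈ D
      boundary : PairMark t (prev ++ unit (p t))

  unit-step : ∀ {t D prev x y w τ} → Pairs t D prev → x ≡ p t → 1 ≤ y → y ≤ Z → x ≤ Z →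
              (∀ {d} → PairMark t d → Pre d (unit x ++ unit y ++ w) → length d ≤ length (unit x)) →
              (∀ {d} → PairMark t d → Pre d (unit y ++ w) → length d ≤ length (unit y)) →
              (∀ {D′} → (∀ {d} → d ∈ D′ → d ≡ unit x ++ unit y ⊎ PairMark t d) → (∀ {d} → d ∈ D → d ∈ D′) →
                unit x ++ unit y ∈ D′ → Slow D′ (unit y) w τ) →
              Slow D prev (unit x ++ unit y ++ w) τ
  unit-step {t} {D} {prev} {x} {y} {w} ps refl 1≤y y≤Z x≤Z max₁ max₂ k =
    step {g = 0} (unit-nonempty x) (unit-nonempty y) refl
      (longest-among (unit-nonempty x) (∈-++⁺ˡ (units (s≤s z≤n) x≤Z)) refl (max₁ ∘ marks))
      (longest-among (unit-nonempty y) (∈-++⁺ˡ (∈-++⁺ʳ (extra prev (unit x)) (units 1≤y y≤Z))) refl (max₂ ∘ marks′))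
      z≤n
      (k (λ { (here e) → inj₁ e ; (there d∈) → inj₂ (marks′ d∈) }) (there ∘ ∈-++⁺ʳ _) (here refl))
    where
    open Pairs ps
    marks′ : ∀ {d} → d ∈ extra prev (unit x) ++ D → PairMark t d
    marks′ d∈ with ∈-++⁻ (extra prev (unit x)) d∈
    ... | inj₁ d∈ with refl , _ ← extra-∈ d∈ = boundary
    ... | inj₂ d∈ = marks d∈

  -- No earlier code equals `code t`; straddling marks are excluded at its first unit by the
  -- disjoint ranges and at its second by `qp-injective`. The latter looks at the unit after the
  -- code, which is why `w` has to start with `unit (p (suc t))`.
  pair-step : ∀ {t D prev w z τ} → t < M → w ≡ unit (p (suc t)) ++ z → Pairs t D prev →
              (∀ {D′} → Pairs (suc t) D′ (unit (q t)) → Slow D′ (unit (q t)) w τ) →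
              Slow D prev (unit (p t) ++ unit (q t) ++ w) τ
  pair-step {t} {D} {prev} {w} {z} t<M refl ps k =
    unit-step ps refl (s≤s z≤n) (<⇒≤ (q<Z t)) p≤Z max₁ max₂ λ marks′ D⊆ new → k record
      { marks = λ d∈ → grow (marks′ d∈)
      ; units = λ 1≤ ≤Z → D⊆ (units 1≤ ≤Z)
      ; codes = λ s< → codes′ D⊆ new s<
      ; boundary = inj₂ (inj₂ (t , ≤-refl , refl)) }
    where
    open Pairs ps
    t≤M = <⇒≤ t<M
    p≤Z : p t ≤ Z
    p≤Z = ≤-trans (p≤ t≤M) (s≤s (≤-trans (m≤m+n H H) (n≤1+n _)))
    grow : ∀ {d} → d ≡ code t ⊎ PairMark t d → PairMark (suc t) d
    grow (inj₁ e) = inj₂ (inj₁ (t , ≤-refl , e))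
    grow (inj₂ m) = PairMark-suc m
    codes′ : ∀ {D′ s} → (∀ {d} → d ∈ D → d ∈ D′) → code t ∈ D′ → s < suc t → code s ∈ D′
    codes′ D⊆ new (s≤s s≤) with m≤n⇒m<n∨m≡n s≤
    ... | inj₁ s<   = D⊆ (codes s<)
    ... | inj₂ refl = new
    max₁ : ∀ {d} → PairMark t d → Pre d (unit (p t) ++ unit (q t) ++ w) → length d ≤ length (unit (p t))
    max₁ (inj₁ short) pre = short p≤Z pre
    max₁ (inj₂ (inj₁ (s , s<t , refl))) (_ , e)
      with e₁ , e₂ , _ ← units-cancel (p s) (q s) (p t) (q t) e = contradiction (pq-injective e₁ e₂) (<⇒≢ s<t)
    max₁ (inj₂ (inj₂ (s , s<t , refl))) (_ , e)
      with _ , e₂ , _ ← units-cancel (q s) (p (suc s)) (p t) (q t) e =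
      contradiction e₂ (p≢q {suc s} {t} (≤-trans s<t t≤M))
    max₂ : ∀ {d} → PairMark t d → Pre d (unit (q t) ++ w) → length d ≤ length (unit (q t))
    max₂ (inj₁ short) pre = short (<⇒≤ (q<Z t)) pre
    max₂ (inj₂ (inj₁ (s , s<t , refl))) (_ , e)
      with e₁ , _ ← units-cancel (p s) (q s) (q t) (p (suc t)) e =
      contradiction e₁ (p≢q {s} {t} (≤-trans (<⇒≤ s<t) t≤M))
    max₂ (inj₂ (inj₂ (s , s<t , refl))) (_ , e)
      with e₁ , e₂ , _ ← units-cancel (q s) (p (suc s)) (q t) (p (suc t)) e =
      contradiction (qp-injective e₁ e₂) (<⇒≢ s<t)

  -- Shared by all marks of the coding phase: matched at the start of a token they never reach
  -- beyond it, so no later search prefers them to the token itself.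
  Short : BStr → Set
  Short d = ∀ {t z} → t < M → Pre d (code t ++ z) → length d ≤ length (code t)

  record Coded (D : List BStr) (prev : BStr) : Set where
    field
      short : ∀ {d} → d ∈ D → Short d
      codes : ∀ {t} → t < M → code t ∈ D
      prev-short : ∀ z → Short (prev ++ z)

  ShortU⇒Short : ∀ {d} → ShortU d → Short d
  ShortU⇒Short short {t} {z} t<M pre =
    ≤-trans (short p≤Z (subst (Pre _) (++-assoc (unit (p t)) (unit (q t)) z) pre))
            (≤-trans (m≤m+n _ _) (≤-reflexive (sym (length-++ (unit (p t))))))
    where
    p≤Z : p t ≤ Z
    p≤Z = ≤-trans (p≤ (<⇒≤ t<M)) (s≤s (≤-trans (m≤m+n H H) (n≤1+n _)))

  PairMark⇒Short : ∀ {d} → PairMark M d → Short d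
  PairMark⇒Short (inj₁ short) = ShortU⇒Short short
  PairMark⇒Short (inj₂ (inj₁ (s , s<M , refl))) {t} t<M (z , e) with refl , _ ← code-cancel s t e = ≤-refl
  PairMark⇒Short (inj₂ (inj₂ (s , s<M , refl))) {t} {z} t<M (_ , e)
    with _ , e₂ , _ ← units-cancel (q s) (p (suc s)) (p t) (q t) (trans e (++-assoc (unit (p t)) (unit (q t)) z)) =
    contradiction e₂ (p≢q {suc s} {t} s<M)

  -- Closes the coding phase. No code begins with `unit Z`, so whatever LZMW forms with it as
  -- previous phrase never matches at a token.
  last-step : ∀ {D prev w τ} → Pairs M D prev → (∀ {D′ prev′} → Coded D′ prev′ → Slow D′ prev′ w τ) →
              Slow D prev (unit (p M) ++ unit Z ++ w) τ
  last-step {D} {prev} {w} ps k =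
    unit-step ps refl (s≤s z≤n) ≤-refl p≤Z max₁ max₂ λ marks′ D⊆ new → k record
      { short = λ d∈ → short′ (marks′ d∈)
      ; codes = λ t< → D⊆ (codes t<)
      ; prev-short = λ { z {t} {y} t<M (x , e) → contradiction
          (sym (proj₁ (unit-cancel Z (p t) (trans (sym (++-assoc (unit Z) z x)) (trans e (++-assoc (unit (p t)) _ y))))))
          (p≢Z (<⇒≤ t<M)) } }
    where
    open Pairs ps
    p≤Z : p M ≤ Z
    p≤Z = ≤-trans (p≤ ≤-refl) (s≤s (≤-trans (m≤m+n H H) (n≤1+n _)))
    short′ : ∀ {d} → d ≡ unit (p M) ++ unit Z ⊎ PairMark M d → Short d
    short′ (inj₂ m) = PairMark⇒Short m
    short′ (inj₁ refl) {t} {z} t<M (_ , e)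
      with _ , e₂ , _ ← units-cancel (p M) Z (p t) (q t) (trans e (++-assoc (unit (p t)) (unit (q t)) z)) =
      contradiction (sym e₂) (<⇒≢ (q<Z t))
    max₁ : ∀ {d} → PairMark M d → Pre d (unit (p M) ++ unit Z ++ w) → length d ≤ length (unit (p M))
    max₁ (inj₁ short) pre = short p≤Z pre
    max₁ (inj₂ (inj₁ (s , s<t , refl))) (_ , e)
      with _ , e₂ , _ ← units-cancel (p s) (q s) (p M) Z e = contradiction e₂ (<⇒≢ (q<Z s))
    max₁ (inj₂ (inj₂ (s , s<t , refl))) (_ , e)
      with e₁ , _ ← units-cancel (q s) (p (suc s)) (p M) Z e = contradiction (sym e₁) (p≢q {M} {s} ≤-refl)
    max₂ : ∀ {d} → PairMark M d → Pre d (unit Z ++ w) → length d ≤ length (unit Z)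
    max₂ (inj₁ short) pre = short ≤-refl pre
    max₂ (inj₂ (inj₁ (s , s<t , refl))) (y , e) =
      contradiction (proj₁ (unit-cancel (p s) Z (trans (sym (++-assoc (unit (p s)) _ y)) e))) (p≢Z (<⇒≤ s<t))
    max₂ (inj₂ (inj₂ (s , s<t , refl))) (y , e) =
      contradiction (proj₁ (unit-cancel (q s) Z (trans (sym (++-assoc (unit (q s)) _ y)) e))) (<⇒≢ (q<Z s))

  pairText : ℕ → ℕ → BStr
  pairText t zero    = unit (p t) ++ unit Z
  pairText t (suc j) = code t ++ pairText (suc t) j

  pairText-head : ∀ t j → ∃[ z ] pairText t j ≡ unit (p t) ++ z
  pairText-head t zero    = _ , refl
  pairText-head t (suc j) = _ , ++-assoc (unit (p t)) _ _

  pairs : ∀ {w τ} j {t D prev} → t + j ≡ M → Pairs t D prev →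
          (∀ {D′ prev′} → Coded D′ prev′ → Slow D′ prev′ w τ) → Slow D prev (pairText t j ++ w) τ
  pairs {w} {τ} zero {t} {D} {prev} t≡ ps k with refl ← trans (sym (+-identityʳ t)) t≡ =
    subst (λ x → Slow D prev x τ) (sym (++-assoc (unit (p M)) (unit Z) w)) (last-step ps k)
  pairs {w} {τ} (suc j) {t} {D} {prev} t≡ ps k =
    subst (λ x → Slow D prev x τ) split
      (pair-step (≤-trans (m≤m+n (suc t) j) (≤-reflexive st≡))
        (trans (cong (_++ w) (proj₂ (pairText-head (suc t) j))) (++-assoc (unit (p (suc t))) _ w))
        ps (λ ps′ → pairs j st≡ ps′ k))
    where
    st≡ : suc t + j ≡ M
    st≡ = trans (sym (+-suc t j)) t≡
    split : unit (p t) ++ unit (q t) ++ (pairText (suc t) j ++ w) ≡ (code t ++ pairText (suc t) j) ++ w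
    split = trans (sym (++-assoc (unit (p t)) (unit (q t)) _)) (sym (++-assoc (code t) (pairText (suc t) j) w))

  codeText : BStr
  codeText = a ∷ b ∷ chainText 0 (suc Z) ++ pairText 0 M

  coding : ∀ {w τ} → (∀ {D prev} → Coded D prev → Slow D prev w τ) → τ ≤ time (codeText ++ w)
  coding {w} {τ} k = start (subst (λ x → Slow ((a ∷ b ∷ []) ∷ []) (b ∷ []) x τ) (sym (++-assoc (chainText 0 (suc Z)) _ w))
    (chain (suc Z) chain₀ λ ch → pairs M refl (pairs₀ ch) k))
    where
    chain₀ : Chain 0 ((a ∷ b ∷ []) ∷ [])
    chain₀ = record { marks = λ { (here refl) → inj₁ (1 , ≤-refl , refl) }
                    ; runs = λ { {suc zero} _ _ → here refl ; {suc (suc j)} _ (s≤s ()) } ; units = λ _ () }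
    pairs₀ : ∀ {D} → Chain (suc Z) D → Pairs 0 D (run (suc Z) [])
    pairs₀ {D} ch = record { marks = λ d∈ → inj₁ (short (Chain.marks ch d∈))
                       ; units = λ 1≤ i≤ → Chain.units ch 1≤ (s≤s i≤) ; codes = λ ()
                       -- The last phrase of the chain has exponent `Z + 1`, larger than that of any
                       -- unit in use.
                       ; boundary = inj₁ λ { {i} {z} i≤ (y , e) → contradiction
                           (proj₁ (run-injective (suc Z) i (trans (sym (run-++ (suc Z) _ y))
                             (trans (cong (_++ y) (sym (run-++ (suc Z) [] (unit (p 0))))) (trans e (run-++ i tail z))))))
                           (<⇒≢ (s≤s i≤) ∘ sym) } }
      where
      short : ∀ {d} → ChainMark (suc Z) d → ShortU d
      short (inj₁ (j , _ , refl)) {i} {z} _ (y , e)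
        with refl , _ ← run-injective j i (trans (sym (run-++ j [] y)) (trans e (run-++ i tail z))) =
        ≤-trans (≤-reflexive (length-run j [])) (≤-trans (s≤s (+-monoʳ-≤ j z≤n)) (≤-reflexive (sym (length-run j tail))))
      short (inj₂ (t≡ , j , _ , refl)) {i} {z} _ (y , e)
        with refl , _ ← run-injective j i (trans (sym (run-++ j (a ∷ []) y)) (trans e (run-++ i tail z))) =
        ≤-reflexive (cong (length ∘ run j) (sym t≡))

-- Intervals of tokens

iv : ℕ → ℕ → List ℕ
iv x zero    = []
iv x (suc m) = x ∷ iv (suc x) m

iv-++ : ∀ x m l → iv x (m + l) ≡ iv x m ++ iv (x + m) l
iv-++ x zero    l = cong (λ y → iv y l) (sym (+-identityʳ x))
iv-++ x (suc m) l = cong (x ∷_) (trans (iv-++ (suc x) m l) (cong (λ y → iv (suc x) m ++ iv y l) (sym (+-suc x m))))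

length-iv : ∀ x m → length (iv x m) ≡ m
length-iv x zero    = refl
length-iv x (suc m) = cong suc (length-iv (suc x) m)

iv-< : ∀ x m {n} → x + m ≤ n → All (_< n) (iv x m)
iv-< x zero    _  = []
iv-< x (suc m) le = ≤-trans (s≤s (m≤m+n x m)) le′ ∷ iv-< (suc x) m le′
  where le′ = ≤-trans (≤-reflexive (sym (+-suc x m))) le

iv-prefix : ∀ x′ s x m {u} → iv x′ s ++ u ≡ iv x m → s ≡ 0 ⊎ (x′ ≡ x × s ≤ m)
iv-prefix x′ zero    x m       _ = inj₁ refl
iv-prefix x′ (suc s) x (suc m) e with ∷-injectiveˡ e | iv-prefix (suc x′) s (suc x) m (∷-injectiveʳ e)
... | refl | inj₁ refl     = inj₂ (refl , s≤s z≤n)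
... | refl | inj₂ (_ , s≤) = inj₂ (refl , s≤s s≤)

-- Reading and marking intervals in front of separators

module Intervals (alg : Algorithm) (H : ℕ) .{{_ : NonZero H}} (W : ℕ) (W≤M : W ≤ Codes.M alg H) where
  open Algorithm alg
  open Codes alg H using (code; code-cancel; M; Short; unit-nonempty; unit; p; q)

  enc : List ℕ → BStr
  enc []      = []
  enc (t ∷ v) = code t ++ enc v

  enc-++ : ∀ u v → enc (u ++ v) ≡ enc u ++ enc v
  enc-++ []      v = refl
  enc-++ (t ∷ u) v = trans (cong (code t ++_) (enc-++ u v)) (sym (++-assoc (code t) (enc u) (enc v)))

  enc-iv-++ : ∀ x m l → enc (iv x (m + l)) ≡ enc (iv x m) ++ enc (iv (x + m) l)
  enc-iv-++ x m l = trans (cong enc (iv-++ x m l)) (enc-++ (iv x m) (iv (x + m) l))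

  enc-nonempty : ∀ t v → 1 ≤ length (enc (t ∷ v))
  enc-nonempty t v = begin
    1                                 ≤⟨ unit-nonempty (p t) ⟩
    length (unit (p t))               ≤⟨ m≤m+n _ _ ⟩
    length (unit (p t)) + length (unit (q t)) ≡⟨ length-++ (unit (p t)) ⟨
    length (code t)                   ≤⟨ m≤m+n _ _ ⟩
    length (code t) + length (enc v)  ≡⟨ length-++ (code t) ⟨
    length (enc (t ∷ v))              ∎
    where open ≤-Reasoning

  enc-iv-mono : ∀ x {s m} → s ≤ m → length (enc (iv x s)) ≤ length (enc (iv x m))
  enc-iv-mono x {s} s≤m with l , refl ← m≤n⇒∃[o]m+o≡n s≤m = begin
    length (enc (iv x s))                                 ≤⟨ m≤m+n _ _ ⟩
    length (enc (iv x s)) + length (enc (iv (x + s) l))   ≡⟨ length-++ (enc (iv x s)) ⟨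
    length (enc (iv x s) ++ enc (iv (x + s) l))           ≡⟨ cong length (enc-iv-++ x s l) ⟨
    length (enc (iv x (s + l)))                           ∎
    where open ≤-Reasoning

  -- Codes are uniquely decodable, and the separator `n` does not occur in a mark over tokens below
  -- `n`; such a mark therefore ends before it.
  decode : ∀ {n y z} u v → All (_< n) u → enc u ++ y ≡ enc v ++ code n ++ z → ∃[ r ] u ++ r ≡ v
  decode []      v       _          _ = v , refl
  decode {n} {y} (s ∷ u) [] (s<n ∷ _) e =
    contradiction (proj₁ (code-cancel s n (trans (sym (++-assoc (code s) (enc u) y)) e))) (<⇒≢ s<n)
  decode {n} {y} {z} (s ∷ u) (t ∷ v) (_ ∷ u<n) e
    with refl , e′ ← code-cancel s t (trans (sym (++-assoc (code s) (enc u) y)) (trans e (++-assoc (code t) (enc v) _)))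
    with r , refl ← decode u v u<n e′ = r , refl

  Family : Set₁
  Family = ℕ → ℕ → Set

  ∅ : Family
  ∅ _ _ = ⊥

  -- Tokens ≥ W are separators: each is read once, so a mark containing one never matches again.
  Mark : ℕ → Family → List ℕ → Set
  Mark n U v = All (_< n) v × (Any (W ≤_) v ⊎ ∃[ x ] ∃[ m ] (v ≡ iv x m × U x m))

  -- `Short` covers what the coding phase left behind. `U` only bounds the marked intervals from
  -- above: it may list intervals that are not in the dictionary.
  Allowed : ℕ → Family → BStr → Set
  Allowed n U d = Short d ⊎ ∃[ v ] (d ≡ enc v × Mark n U v)

  Allowed-mono : ∀ {n n′ U U′ d} → n ≤ n′ → (∀ {x m} → U x m → U′ x m) → Allowed n U d → Allowed n′ U′ d
  Allowed-mono n≤ U⊆ (inj₁ short) = inj₁ short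
  Allowed-mono n≤ U⊆ (inj₂ (v , e , v< , inj₁ dead)) = inj₂ (v , e , All.map (λ t< → ≤-trans t< n≤) v< , inj₁ dead)
  Allowed-mono n≤ U⊆ (inj₂ (v , e , v< , inj₂ (x , m , e′ , u))) =
    inj₂ (v , e , All.map (λ t< → ≤-trans t< n≤) v< , inj₂ (x , m , e′ , U⊆ u))

  record Core (n : ℕ) (U : Family) (D : List BStr) : Set where
    field
      marks   : ∀ {d} → d ∈ D → Allowed n U d
      singles : ∀ {t} → t < M → enc (t ∷ []) ∈ D

  _⊆′_ : List BStr → List BStr → Set
  D ⊆′ D′ = ∀ {d} → d ∈ D → d ∈ D′

  Core-extra : ∀ {n U D prev c} → Core n U D → Allowed n U (prev ++ c) → Core n U (extra prev c ++ D)
  Core-extra {n} {U} {D} {prev} {c} core ok = record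
    { marks = λ d∈ → from (∈-++⁻ (extra prev c) d∈) ; singles = λ t< → ∈-++⁺ʳ (extra prev c) (Core.singles core t<) }
    where
    from : ∀ {d} → d ∈ extra prev c ⊎ d ∈ D → Allowed n U d
    from (inj₁ d∈) with refl , _ ← extra-∈ d∈ = ok
    from (inj₂ d∈) = Core.marks core d∈

  lookup : ∀ {n U D t v w z} → Core n U D → t < M → enc (t ∷ v) ∈ D → w ≡ enc (t ∷ v) ++ z →
           (∀ {u} → Mark n U u → Pre (enc u) w → length (enc u) ≤ length (enc (t ∷ v))) →
           Longest (D ++ Σ-letters) (enc (t ∷ v)) w
  lookup {D = D} {t} {v} {w} {z} core t< mem refl max =
    longest-among (enc-nonempty t v) (∈-++⁺ˡ mem) refl λ d∈ → bound (Core.marks core d∈)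
    where
    bound : ∀ {d} → Allowed _ _ d → Pre d w → length d ≤ length (enc (t ∷ v))
    bound (inj₁ short) pre = ≤-trans (short t< (subst (Pre _) (++-assoc (code t) (enc v) z) pre))
      (≤-trans (m≤m+n _ _) (≤-reflexive (sym (length-++ (code t)))))
    bound (inj₂ (u , refl , mark)) pre = max mark pre

  -- Only marks of length between `m + 1` and `m + r` could win. Longer ones would have to match the
  -- fresh separator `n`; this alternative is what keeps the deep strings from being returned.
  lookup-iv : ∀ {n U D x x′ m r w z} → Core n U D → W ≤ n → 1 ≤ m → x′ ≡ x + m → x′ + r ≤ W → enc (iv x m) ∈ D →
              w ≡ enc (iv x m) ++ enc (iv x′ r) ++ code n ++ z → (∀ s → U x s → s ≤ m ⊎ m + r < s) →
              Longest (D ++ Σ-letters) (enc (iv x m)) w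
  lookup-iv {n} {U} {x = x} {m = suc m} {r} {w} {z} core W≤n _ refl end≤ mem w≡ top =
    lookup {t = x} {v = iv (suc x) m} core (≤-trans x< W≤M) mem w≡ bound
    where
    end≤′ : x + (suc m + r) ≤ W
    end≤′ = ≤-trans (≤-reflexive (sym (+-assoc x (suc m) r))) end≤
    x< : x < W
    x< = ≤-trans (s≤s (m≤m+n x (m + r))) (≤-trans (≤-reflexive (sym (+-suc x (m + r)))) end≤′)
    bound : ∀ {u} → Mark n U u → Pre (enc u) w → length (enc u) ≤ length (enc (iv x (suc m)))
    bound {u} (u< , kind) (y , e) with decode {n} {y} {z} u (iv x (suc m + r)) u<
      (trans e (trans w≡ (trans (sym (++-assoc (enc (iv x (suc m))) _ _)) (cong (_++ code n ++ z) (sym (enc-iv-++ x (suc m) r))))))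
    bound {u} (u< , inj₁ dead) _ | rest , eq =
      ⊥-elim (no-dead (subst (Any (W ≤_)) eq (Any-++⁺ˡ dead)) (iv-< x (suc m + r) end≤′))
      where
      no-dead : ∀ {v} → Any (W ≤_) v → All (_< W) v → ⊥
      no-dead (here W≤t)  (t<W ∷ _) = <⇒≱ t<W W≤t
      no-dead (there any) (_ ∷ all) = no-dead any all
    bound {u} (u< , inj₂ (x₀ , s , refl , Us)) _ | rest , eq with iv-prefix x₀ s x (suc m + r) eq
    ... | inj₁ refl = z≤n
    ... | inj₂ (refl , s≤) with top s Us
    ...   | inj₁ s≤m = enc-iv-mono x s≤m
    ...   | inj₂ s>  = contradiction s≤ (<⇒≱ s>)

  lookup-separator : ∀ {n U D z} → Core n U D → n < M → Longest (D ++ Σ-letters) (enc (n ∷ [])) (enc (n ∷ []) ++ z)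
  lookup-separator {n} {U} {z = z} core n<M = lookup {v = []} core n<M (Core.singles core n<M) refl bound
    where
    bound : ∀ {u} → Mark n U u → Pre (enc u) (enc (n ∷ []) ++ z) → length (enc u) ≤ length (enc (n ∷ []))
    bound {[]}    _        _       = z≤n
    bound {s ∷ u} (u< , _) (y , e) with decode {n} {y} {z} (s ∷ u) [] u< (trans e (++-assoc (code n) [] z))
    ... | _ , ()

  -- `r` counts the tokens left between the pair and the separator, against which both searches are
  -- measured. `U` has to cover `prev ++ enc (iv x m)` as well, since LZMW marks it before the
  -- second search.
  pair-step : ∀ {n U U′ D prev x x₁ x₂ m l r w z g τ} → Core n U D → W ≤ n → 1 ≤ m → 1 ≤ l →
              x₁ ≡ x + m → x₂ ≡ x₁ + l → x₂ + r ≤ W →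
              w ≡ enc (iv x m) ++ enc (iv x₁ l) ++ enc (iv x₂ r) ++ code n ++ z →
              enc (iv x m) ∈ D → enc (iv x₁ l) ∈ D →
              (∀ s → U x s → s ≤ m ⊎ m + (l + r) < s) → (∀ s → U x₁ s → s ≤ l ⊎ l + r < s) →
              Allowed n U (prev ++ enc (iv x m)) → (∀ {x m} → U x m → U′ x m) → U′ x (m + l) →
              g ≤ trieMatch D w →
              (∀ {D′} → D ⊆′ D′ → enc (iv x (m + l)) ∈ D′ → Core n U′ D′ →
                Slow D′ (enc (iv x₁ l)) (enc (iv x₂ r) ++ code n ++ z) τ) →
              Slow D prev w (g + τ)
  pair-step {n} {U} {U′} {D} {prev} {x} {m = m@(suc m′)} {l = l@(suc l′)} {r} {z = z} core W≤n 1≤m 1≤l refl refl end≤ refl A∈ C∈ top₁ top₂ ok U⊆ new g≤ k =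
    step (enc-nonempty x (iv (suc x) m′)) (enc-nonempty (x + m) (iv (suc (x + m)) l′)) refl
      (lookup-iv core W≤n 1≤m refl end≤′ A∈ (cong (enc (iv x m) ++_) join) top₁)
      (lookup-iv (Core-extra core ok) W≤n 1≤l refl end≤ (∈-++⁺ʳ (extra prev (enc (iv x m))) C∈) refl top₂)
      g≤
      (k (there ∘ ∈-++⁺ʳ _) (here (enc-iv-++ x m l)) record
        { marks = marks′ ; singles = λ t< → there (Core.singles (Core-extra core ok) t<) })
    where
    end≤′ : x + m + (l + r) ≤ W
    end≤′ = ≤-trans (≤-reflexive (sym (+-assoc (x + m) l r))) end≤
    join : enc (iv (x + m) l) ++ enc (iv (x + m + l) r) ++ code n ++ z ≡ enc (iv (x + m) (l + r)) ++ code n ++ z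
    join = trans (sym (++-assoc (enc (iv (x + m) l)) _ _)) (cong (_++ code n ++ z) (sym (enc-iv-++ (x + m) l r)))
    small : All (_< n) (iv x (m + l))
    small = iv-< x (m + l) (≤-trans (≤-trans (≤-reflexive (sym (+-assoc x m l))) (m≤m+n _ r)) (≤-trans end≤ W≤n))
    marks′ : ∀ {d} → d ∈ (enc (iv x m) ++ enc (iv (x + m) l)) ∷ extra prev (enc (iv x m)) ++ D → Allowed n U′ d
    marks′ (here refl) = inj₂ (iv x (m + l) , sym (enc-iv-++ x m l) , small , inj₂ (x , m + l , refl , new))
    marks′ (there d∈)  = Allowed-mono ≤-refl U⊆ (Core.marks (Core-extra core ok) d∈)

  -- The empty family says that the product LZMW forms from `prev` and the next phrase is short or
  -- contains a separator, so it adds no interval to keep track of.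
  Safe : ℕ → BStr → Set
  Safe n prev = ∀ {m v} → n ≤ m → All (_< m) v → Allowed m ∅ (prev ++ enc v)

  separators : ℕ → BStr
  separators n = enc (n ∷ suc n ∷ [])

  separate : ∀ {n U D prev w τ} → Core n U D → W ≤ n → suc n < M → Allowed (suc n) U (prev ++ enc (n ∷ [])) →
             (∀ {D′ prev′} → D ⊆′ D′ → Core (2 + n) U D′ → Safe (2 + n) prev′ → Slow D′ prev′ w τ) →
             Slow D prev (separators n ++ w) τ
  separate {n} {U} {D} {prev} {w} core W≤n n<M ok k =
    step {c₁ = enc (n ∷ [])} {c₂ = enc (suc n ∷ [])} {g = 0} (enc-nonempty n []) (enc-nonempty (suc n) []) split
      (subst (Longest _ _) (sym split) (lookup-separator core (<⇒≤ n<M)))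
      (lookup-separator core′ n<M) z≤n
      (k (there ∘ ∈-++⁺ʳ _) record { marks = marks′ ; singles = λ t< → there (Core.singles core′ t<) } safe)
    where
    split : separators n ++ w ≡ enc (n ∷ []) ++ enc (suc n ∷ []) ++ w
    split = trans (cong (_++ w) (enc-++ (n ∷ []) (suc n ∷ []))) (++-assoc (enc (n ∷ [])) (enc (suc n ∷ [])) w)
    core′ : Core (suc n) U (extra prev (enc (n ∷ [])) ++ D)
    core′ = Core-extra (record { marks = λ d∈ → Allowed-mono (n≤1+n n) (λ u → u) (Core.marks core d∈)
                               ; singles = Core.singles core }) ok
    marks′ : ∀ {d} → d ∈ (enc (n ∷ []) ++ enc (suc n ∷ [])) ∷ extra prev (enc (n ∷ [])) ++ D → Allowed (2 + n) U d
    marks′ (here refl) = inj₂ (n ∷ suc n ∷ [] , sym (enc-++ (n ∷ []) (suc n ∷ [])) ,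
                               s≤s (n≤1+n n) ∷ ≤-refl ∷ [] , inj₁ (here W≤n))
    marks′ (there d∈)  = Allowed-mono (n≤1+n _) (λ u → u) (Core.marks core′ d∈)
    safe : Safe (2 + n) (enc (suc n ∷ []))
    safe {v = v} n≤ v< = inj₂ (suc n ∷ v , sym (enc-++ (suc n ∷ []) v) , n≤ ∷ v< , inj₁ (here (≤-trans W≤n (n≤1+n n))))

  Allowed-∅ : ∀ {n U d} → Allowed n ∅ d → Allowed n U d
  Allowed-∅ = Allowed-mono ≤-refl (λ ())

  closed-by-separator : ∀ {n U} v → W ≤ n → All (_< n) v → Allowed (suc n) U (enc v ++ enc (n ∷ []))
  closed-by-separator {n} v W≤n v< = inj₂ (v ++ n ∷ [] , sym (enc-++ v (n ∷ [])) ,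
    All-++⁺ (All.map m<n⇒m<1+n v<) (≤-refl ∷ []) , inj₁ (Any-++⁺ʳ v (here W≤n)))

  -- Two separators rather than one keep LZD aligned on phrase boundaries.
  insert : ∀ {n U U′ D prev x x₁ m l w τ} → Core n U D → Safe n prev → W ≤ n → suc n < M → 1 ≤ m → 1 ≤ l →
           x₁ ≡ x + m → x₁ + l ≤ W → enc (iv x m) ∈ D → enc (iv x₁ l) ∈ D →
           (∀ s → U x s → s ≤ m ⊎ m + l < s) →
           (∀ {x m} → U x m → U′ x m) → U′ x (m + l) →
           (∀ {D′ prev′} → D ⊆′ D′ → enc (iv x (m + l)) ∈ D′ → Core (2 + n) U′ D′ → Safe (2 + n) prev′ → Slow D′ prev′ w τ) →
           Slow D prev (enc (iv x (m + l) ++ n ∷ suc n ∷ []) ++ w) τ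
  insert {n} {U} {U′} {D} {prev} {x} {m = m} {l} {w} {τ} core safe W≤n n<M 1≤m 1≤l refl end≤ A∈ C∈ top₁ U⊆ new k =
    pair-step {x₂ = x + m + l} {r = 0} {g = 0} core W≤n 1≤m 1≤l refl refl (≤-trans (≤-reflexive (+-identityʳ _)) end≤) split A∈ C∈
      (λ s u → subst (λ y → s ≤ m ⊎ m + y < s) (sym (+-identityʳ l)) (top₁ s u))
      (λ s _ → subst (λ y → s ≤ l ⊎ y < s) (sym (+-identityʳ l)) (≤-<-connex s l))
      (Allowed-∅ (safe ≤-refl (iv-< x m (≤-trans (m≤m+n _ l) (≤-trans end≤ W≤n))))) U⊆ new z≤n
      λ {D′} D⊆ new∈ core′ → subst (λ y → Slow D′ (enc (iv (x + m) l)) y τ) (++-assoc (code n) _ w)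
        (separate core′ W≤n n<M (closed-by-separator (iv (x + m) l) W≤n (iv-< (x + m) l (≤-trans end≤ W≤n)))
          λ D′⊆ core″ safe′ → k (D′⊆ ∘ D⊆) (D′⊆ new∈) core″ safe′)
    where
    open ≡-Reasoning
    split : enc (iv x (m + l) ++ n ∷ suc n ∷ []) ++ w ≡
            enc (iv x m) ++ enc (iv (x + m) l) ++ enc (iv (x + m + l) 0) ++ code n ++ enc (suc n ∷ []) ++ w
    split = begin
      enc (iv x (m + l) ++ n ∷ suc n ∷ []) ++ w                ≡⟨ cong (_++ w) (enc-++ (iv x (m + l)) _) ⟩
      (enc (iv x (m + l)) ++ separators n) ++ w                ≡⟨ cong (λ y → (y ++ separators n) ++ w) (enc-iv-++ x m l) ⟩
      ((enc (iv x m) ++ enc (iv (x + m) l)) ++ separators n) ++ w ≡⟨ ++-assoc (enc (iv x m) ++ enc (iv (x + m) l)) _ w ⟩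
      (enc (iv x m) ++ enc (iv (x + m) l)) ++ separators n ++ w ≡⟨ ++-assoc (enc (iv x m)) _ _ ⟩
      enc (iv x m) ++ enc (iv (x + m) l) ++ separators n ++ w  ≡⟨ cong (λ y → enc (iv x m) ++ enc (iv (x + m) l) ++ y) (++-assoc (code n) _ w) ⟩
      enc (iv x m) ++ enc (iv (x + m) l) ++ code n ++ enc (suc n ∷ []) ++ w ∎

-- Offsets in steps of three and the roles of positions

triple : ℕ → ℕ
triple zero    = 0
triple (suc l) = 3 + triple l

triple-+ : ∀ l j → triple (l + j) ≡ triple l + triple j
triple-+ zero    j = refl
triple-+ (suc l) j = cong (3 +_) (triple-+ l j)

triple-mono : ∀ {l j} → l ≤ j → triple l ≤ triple j
triple-mono {l} l≤j with o , refl ← m≤n⇒∃[o]m+o≡n l≤j = ≤-trans (m≤m+n _ _) (≤-reflexive (sym (triple-+ l o)))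

triple≡3* : ∀ l → triple l ≡ 3 * l
triple≡3* zero    = refl
triple≡3* (suc l) = trans (cong (3 +_) (triple≡3* l)) (sym (*-suc 3 l))

-- Round m parses a block of k tokens as [0, 3m+2) [3m+2] [3m+3] [3m+4, k).  Offset 0 is the
-- first position, and offsets 3l + 1, 3l + 2, 3l + 3 are reserved for the starts of the fourth
-- (rest), second (mid) and third (single) phrase, so that no such position is used twice.
data Role : Set where
  first           : Role
  rest mid single : ℕ → Role

next : Role → Role
next first      = first
next (rest l)   = rest (suc l)
next (mid l)    = mid (suc l)
next (single l) = single (suc l)

role : ℕ → Role
role 0 = first
role 1 = rest 0
role 2 = mid 0
role 3 = single 0
role (suc (suc (suc (suc n)))) = next (role (suc n))

role-rest : ∀ l → role (1 + triple l) ≡ rest l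
role-rest zero    = refl
role-rest (suc l) = cong next (role-rest l)

role-mid : ∀ l → role (2 + triple l) ≡ mid l
role-mid zero    = refl
role-mid (suc l) = cong next (role-mid l)

role-single : ∀ l → role (3 + triple l) ≡ single l
role-single zero    = refl
role-single (suc l) = cong next (role-single l)

-- Layouts of blocks and composable stages

module Blocks (alg : Algorithm) (K H : ℕ) .{{_ : NonZero H}} (W≤M : suc (K * (2 + triple K)) ≤ Codes.M alg H) where
  open Algorithm alg
  open Codes alg H using (code; M; Z; length-unit; unit; p; q; p≤; q<Z)

  k W : ℕ
  k = 2 + triple K
  W = suc (K * k)

  open Intervals alg H W W≤M

  -- build l x: the suffixes [3l'+1, k) are marked for l' ≥ l, and [3l-2, 3l-2+x) is under construction.
  -- deep: in addition the interval from offset 1 to W is marked.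
  -- live μ m y: the interval from offset 0 to W is marked too, rounds before m are over (mid phrases
  -- before μ), and the longest other marked interval from offset 0 has length y.
  data Status : Set where
    build : ℕ → ℕ → Status
    deep  : Status
    live  : ℕ → ℕ → ℕ → Status

  -- An upper bound on the marks of length r ending at e: LZMW also inserts pairs that LZD does not,
  -- and positions already used by a round are left unconstrained.
  Up : Status → Role → ℕ → ℕ → Set
  Up (build l₀ x) (rest l)   r e = (l₀ ≤ l × 1 + triple l + r ≤ k) ⊎ (suc l ≡ l₀ × r ≤ x)
  Up (build _ _)  _          r e = ⊥
  Up deep         (rest l)   r e = 1 + triple l + r ≤ k ⊎ e ≡ W
  Up deep         _          r e = ⊥
  Up (live μ m y) first      r e = r ≤ y ⊎ e ≡ W
  Up (live μ m y) (rest l)   r e = l ≤ m ⊎ 1 + triple l + r ≤ k ⊎ e ≡ W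
  Up (live μ m y) (mid l)    r e = l < μ
  Up (live μ m y) (single l) r e = l < m

  Layout : Set
  Layout = ℕ → Status

  U : Layout → Family
  U st x r = Up (st (x / k)) (role (x % k)) r (x + r)

  U-at : ∀ st {ω} β r → ω < k → U st (ω + β * k) r ≡ Up (st β) (role ω) r (ω + β * k + r)
  U-at st {ω} β r ω<k = cong₂ (λ x y → Up (st x) (role y) r (ω + β * k + r)) block offset
    where
    block : (ω + β * k) / k ≡ β
    block = trans (+-distrib-/-∣ʳ ω (n∣m*n β)) (cong₂ _+_ (m<n⇒m/n≡0 ω<k) (m*n/n≡m β k))
    offset : (ω + β * k) % k ≡ ω
    offset = trans ([m+kn]%n≡m%n ω β k) (m<n⇒m%n≡m ω<k)

  upd : ℕ → Status → Layout → Layout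
  upd i s st β with β ≟ i
  ... | yes _ = s
  ... | no  _ = st β

  upd-same : ∀ i s st → upd i s st i ≡ s
  upd-same i s st with i ≟ i
  ... | yes _  = refl
  ... | no i≢i = contradiction refl i≢i

  upd-other : ∀ {i s st β} → β ≢ i → upd i s st β ≡ st β
  upd-other {i} {β = β} β≢i with β ≟ i
  ... | yes β≡i = contradiction β≡i β≢i
  ... | no _    = refl

  U-upd : ∀ {st i s s′} → st i ≡ s → (∀ {c r e} → Up s c r e → Up s′ c r e) →
          ∀ {x r} → U st x r → U (upd i s′ st) x r
  U-upd {st} {i} refl s⊆ {x} u with x / k ≟ i
  ... | yes refl = s⊆ u
  ... | no _     = u

  -- For `l + j = K`, as in `Tails`, this is block `β` from offset `3l + 1` to its end, because
  -- `3l + 1 + 3j + 1 = k`.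
  tail-iv : ℕ → ℕ → ℕ → BStr
  tail-iv β l j = enc (iv (1 + triple l + β * k) (suc (triple j)))

  Tails : ℕ → ℕ → List BStr → Set
  Tails l₀ β D = ∀ l j → l + j ≡ K → l₀ ≤ l → tail-iv β l j ∈ D

  -- The lower counterpart of `Up`: intervals certain to be marked. `γ` only serves to make a deep
  -- interval end at `W`; for `live` this is `βk + 1 + γk = W`.
  Facts : Status → ℕ → List BStr → Set
  Facts (build l₀ x) β D = Tails l₀ β D × (∀ l → suc l ≡ l₀ → enc (iv (1 + triple l + β * k) x) ∈ D)
  Facts deep         β D = Tails 0 β D × (∀ γ → β + suc γ ≡ K → enc (iv (suc (β * k)) (suc (triple K) + suc (γ * k))) ∈ D)
  Facts (live μ m y) β D = Tails 0 β D × (∀ γ → β + γ ≡ K → enc (iv (β * k) (suc (γ * k))) ∈ D) × enc (iv (β * k) y) ∈ D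

  Facts-mono : ∀ s β {D D′} → D ⊆′ D′ → Facts s β D → Facts s β D′
  Facts-mono (build _ _)  β D⊆ (t , c)     = (λ l j e l≤ → D⊆ (t l j e l≤)) , λ l e → D⊆ (c l e)
  Facts-mono deep         β D⊆ (t , c)     = (λ l j e l≤ → D⊆ (t l j e l≤)) , λ γ e → D⊆ (c γ e)
  Facts-mono (live _ _ _) β D⊆ (t , c , s) = (λ l j e l≤ → D⊆ (t l j e l≤)) , (λ γ e → D⊆ (c γ e)) , D⊆ s

  AllFacts : Layout → List BStr → Set
  AllFacts st D = ∀ {β} → β < K → Facts (st β) β D

  AllFacts-upd : ∀ {st i s D D′} → D ⊆′ D′ → AllFacts st D → Facts s i D′ → AllFacts (upd i s st) D′
  AllFacts-upd {st} {i} D⊆ facts new {β} β<K with β ≟ i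
  ... | yes refl = new
  ... | no _     = Facts-mono (st β) β D⊆ (facts β<K)

  record State (st : Layout) (n : ℕ) (D : List BStr) (prev : BStr) : Set where
    field
      core  : Core n (U st) D
      facts : AllFacts st D
      safe  : Safe n prev

  Pred : Set₁
  Pred = ℕ → List BStr → BStr → Set

  At : (Layout → Set) → Pred
  At P n D prev = ∃[ st ] (P st × State st n D prev)

  -- Bounds the length of a code: `(2 + p) + (2 + q)` with `p ≤ H + 1` and `q ≤ 2H + 2`.
  C : ℕ
  C = 7 + 3 * H

  -- Reading some text of at most ℓ tokens leads from I to J, uses δ separators and costs at least g.
  record Stage (I J : Pred) (δ ℓ g : ℕ) : Set where
    constructor stage
    field
      perform : ∀ n → W ≤ n → n + δ ≤ M → ∃[ text ] (length text ≤ ℓ * C ×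
        (∀ {w τ} → (∀ {D prev} → J (n + δ) D prev → Slow D prev w τ) →
          ∀ {D prev} → I n D prev → Slow D prev (text ++ w) (g + τ)))
  open Stage

  infixr 4 _⨾_
  _⨾_ : ∀ {I J L δ δ′ ℓ ℓ′ g g′} → Stage I J δ ℓ g → Stage J L δ′ ℓ′ g′ → Stage I L (δ + δ′) (ℓ + ℓ′) (g + g′)
  perform (_⨾_ {I} {J} {L} {δ} {δ′} {ℓ} {ℓ′} {g} {g′} S T) n W≤n n≤M
    with u , u≤ , f ← perform S n W≤n (≤-trans (+-monoʳ-≤ n (m≤m+n δ δ′)) n≤M)
    with v , v≤ , h ← perform T (n + δ) (≤-trans W≤n (m≤m+n n δ)) (≤-trans (≤-reflexive (+-assoc n δ δ′)) n≤M)
    = u ++ v , len , λ {w} {τ} κ {D} {prev} i →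
      subst₂ (Slow D prev) (sym (++-assoc u v w)) (sym (+-assoc g g′ τ))
        (f (h (λ {D} {prev} l → κ (subst (λ x → L x D prev) (+-assoc n δ δ′) l))) i)
    where
    open ≤-Reasoning
    len : length (u ++ v) ≤ (ℓ + ℓ′) * C
    len = begin
      length (u ++ v)         ≡⟨ length-++ u ⟩
      length u + length v     ≤⟨ +-mono-≤ u≤ v≤ ⟩
      ℓ * C + ℓ′ * C          ≡⟨ *-distribʳ-+ C ℓ ℓ′ ⟨
      (ℓ + ℓ′) * C            ∎

  iterate : ∀ (I : ℕ → Pred) {δ ℓ g} N → (∀ j → j < N → Stage (I j) (I (suc j)) δ ℓ g) →
            Stage (I 0) (I N) (N * δ) (N * ℓ) (N * g)
  iterate I zero    S = stage λ n _ _ → [] , z≤n , λ κ {D} {prev} i → κ (subst (λ x → I 0 x D prev) (sym (+-identityʳ n)) i)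
  iterate I (suc N) S = S 0 (s≤s z≤n) ⨾ iterate (I ∘ suc) N (λ j j<N → S (suc j) (s≤s j<N))

  shift : ∀ {I I′ J J′ : Pred} {δ ℓ ℓ′ g} → (∀ {n D prev} → I′ n D prev → I n D prev) →
          (∀ {n D prev} → J n D prev → J′ n D prev) → ℓ ≤ ℓ′ → Stage I J δ ℓ g → Stage I′ J′ δ ℓ′ g
  perform (shift I⊆ J⊆ ℓ≤ S) n W≤n n≤M with u , u≤ , f ← perform S n W≤n n≤M =
    u , ≤-trans u≤ (*-monoˡ-≤ C ℓ≤) , λ κ i → f (κ ∘ J⊆) (I⊆ i)

  length-code-≤ : ∀ {t} → t < M → length (code t) ≤ C
  length-code-≤ {t} t<M = begin
    length (code t)                              ≡⟨ length-++ (unit (p t)) ⟩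
    length (unit (p t)) + length (unit (q t))    ≤⟨ +-mono-≤ (length-unit (p t)) (length-unit (q t)) ⟩
    (2 + p t) + (2 + q t)                        ≤⟨ +-mono-≤ (+-monoʳ-≤ 2 (p≤ (<⇒≤ t<M))) (+-monoʳ-≤ 2 (<⇒≤ (q<Z t))) ⟩
    (2 + suc H) + (2 + Z)                        ≡⟨ poly H ⟩
    C                                            ∎
    where
    open ≤-Reasoning
    poly : ∀ x → (2 + suc x) + (2 + (2 + (x + x))) ≡ 7 + 3 * x
    poly = solve-∀

  length-enc-≤ : ∀ {v} → All (_< M) v → length (enc v) ≤ length v * C
  length-enc-≤ []                = z≤n
  length-enc-≤ {t ∷ v} (t< ∷ v<) = ≤-trans (≤-reflexive (length-++ (code t))) (+-mono-≤ (length-code-≤ t<) (length-enc-≤ v<))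

  length-enc-≥ : ∀ v → length v * H ≤ length (enc v)
  length-enc-≥ []      = z≤n
  length-enc-≥ (t ∷ v) = ≤-trans (+-mono-≤ code≥ (length-enc-≥ v)) (≤-reflexive (sym (length-++ (code t))))
    where
    code≥ : H ≤ length (code t)
    code≥ = begin
      H                     ≤⟨ m≤m+n H _ ⟩
      H + t % H             ≤⟨ m≤n+m _ 2 ⟩
      q t                   ≤⟨ m≤m+n (q t) _ ⟩
      q t + length tail     ≤⟨ n≤1+n _ ⟩
      suc (q t + length tail) ≡⟨ length-run (q t) tail ⟨
      length (unit (q t))   ≤⟨ m≤n+m _ (length (unit (p t))) ⟩
      length (unit (p t)) + length (unit (q t)) ≡⟨ length-++ (unit (p t)) ⟨
      length (code t)       ∎
      where open ≤-Reasoning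

  Singles : List BStr → Set
  Singles D = ∀ {t} → t < M → enc (t ∷ []) ∈ D

  -- `insert` as a change of status of block `i` from `s` to `s′`. Apart from the presence of the
  -- two marks to be joined, the conditions on marks are local to that block, as `upd` leaves the
  -- others alone.
  insert-stage : ∀ {P P′ : Layout → Set} i ω m l {s s′} → i < K → ω < k → 1 ≤ m → 1 ≤ l → ω + i * k + m + l ≤ W →
    (∀ {st} → P st → st i ≡ s) → (∀ {st} → P st → P′ (upd i s′ st)) →
    (∀ {st D} → P st → AllFacts st D → Singles D → enc (iv (ω + i * k) m) ∈ D × enc (iv (ω + i * k + m) l) ∈ D) →
    (∀ r → Up s (role ω) r (ω + i * k + r) → r ≤ m ⊎ m + l < r) →
    (∀ {c r e} → Up s c r e → Up s′ c r e) → Up s′ (role ω) (m + l) (ω + i * k + (m + l)) →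
    (∀ {D} → Facts s i D → Singles D → enc (iv (ω + i * k) (m + l)) ∈ D → Facts s′ i D) →
    Stage (At P) (At P′) 2 (m + l + 2) 0
  perform (insert-stage {P} {P′} i ω m l {s} {s′} i<K ω<k 1≤m 1≤l end≤ at P⇒ have top s⊆ new facts′) n W≤n n≤M =
    enc text , length-text , go
    where
    text : List ℕ
    text = iv (ω + i * k) (m + l) ++ n ∷ suc n ∷ []
    n<M : suc n < M
    n<M = ≤-trans (≤-reflexive (+-comm 2 n)) n≤M
    end≤′ : ω + i * k + (m + l) ≤ W
    end≤′ = ≤-trans (≤-reflexive (sym (+-assoc (ω + i * k) m l))) end≤
    length-text : length (enc text) ≤ (m + l + 2) * C
    length-text = ≤-trans
      (length-enc-≤ (All-++⁺ (iv-< (ω + i * k) (m + l) (≤-trans end≤′ W≤M)) (<⇒≤ n<M ∷ n<M ∷ [])))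
      (≤-reflexive (cong (_* C) (trans (length-++ (iv (ω + i * k) (m + l))) (cong (_+ 2) (length-iv (ω + i * k) (m + l))))))
    go : ∀ {w τ} → (∀ {D prev} → At P′ (n + 2) D prev → Slow D prev w τ) →
         ∀ {D prev} → At P n D prev → Slow D prev (enc text ++ w) τ
    go κ {D} (st , Pst , state) =
      insert {U′ = U (upd i s′ st)} core safe W≤n n<M 1≤m 1≤l refl end≤ (proj₁ found) (proj₂ found)
        (λ r u → top r (subst (λ x → Up x _ _ _) (at Pst) (subst (λ X → X) (U-at st i r ω<k) u)))
        (U-upd (at Pst) s⊆)
        (subst (λ X → X) (sym (U-at (upd i s′ st) i (m + l) ω<k))
          (subst (λ x → Up x (role ω) (m + l) (ω + i * k + (m + l))) (sym (upd-same i s′ st)) new))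
        λ {D′} {prev′} D⊆ new∈ core′ safe′ → κ (subst (λ x → At P′ x D′ prev′) (+-comm 2 n)
          (upd i s′ st , P⇒ Pst , record
            { core = core′
            ; facts = AllFacts-upd D⊆ facts (facts′ (Facts-mono s i D⊆ (subst (λ x → Facts x i D) (at Pst) (facts i<K)))
                        (Core.singles core′) new∈)
            ; safe = safe′ }))
      where
      open State state
      found = have Pst facts (Core.singles core)

-- Setting up the blocks

module Rounds (alg : Algorithm) (K H : ℕ) .{{_ : NonZero H}} (W≤M : suc (K * (2 + triple K)) ≤ Codes.M alg H) where
  open Algorithm alg
  open Codes alg H using (code; M)
  open Blocks alg K H W≤M
  open Intervals alg H W W≤M

  split-at : ∀ {i γ} → i + γ ≡ K → K * k ≡ i * k + γ * k
  split-at {i} {γ} e = trans (cong (_* k) (sym e)) (*-distribʳ-+ k i γ)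

  fits : ∀ {i} ω m l → i < K → ω + m + l ≤ k → ω + i * k + m + l ≤ W
  fits {i} ω m l i<K le = begin
    ω + i * k + m + l     ≡⟨ poly ω (i * k) m l ⟩
    ω + m + l + i * k     ≤⟨ +-monoˡ-≤ (i * k) le ⟩
    suc i * k             ≤⟨ *-monoˡ-≤ k i<K ⟩
    K * k                 ≤⟨ n≤1+n _ ⟩
    W                     ∎
    where
    open ≤-Reasoning
    poly : ∀ x y z u → x + y + z + u ≡ x + z + u + y
    poly = solve-∀

  below-M : ∀ {i} ω → i < K → ω < k → ω + i * k < M
  below-M {i} ω i<K ω<k = ≤-trans (≤-trans (≤-reflexive (poly ω (i * k)))
    (fits ω 1 0 i<K (≤-trans (≤-reflexive (poly′ ω)) ω<k))) W≤M
    where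
    poly : ∀ x y → suc (x + y) ≡ x + y + 1 + 0
    poly = solve-∀
    poly′ : ∀ x → x + 1 + 0 ≡ suc x
    poly′ = solve-∀

  K-split : ∀ {m j} → suc m + j ≡ K → k ≡ 5 + (triple m + triple j)
  K-split {m} {j} e = trans (cong (λ x → 2 + triple x) (sym e)) (cong (5 +_) (triple-+ m j))

  -- Blocks are prepared from right to left, since the deep string of a block ends with that of the
  -- next one.
  OnBlock : ℕ → Status → Layout → Set
  OnBlock i s st = st i ≡ s × (∀ {β} → β < i → st β ≡ build K 1) × (∀ {β} → i < β → β < K → st β ≡ live 0 0 2)

  OnBlock-upd : ∀ {i s s′ st} → OnBlock i s st → OnBlock i s′ (upd i s′ st)
  OnBlock-upd {i} {s′ = s′} {st} (_ , lo , hi) = upd-same i s′ st ,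
    (λ β<i → trans (upd-other (<⇒≢ β<i)) (lo β<i)) , λ i<β β<K → trans (upd-other (>⇒≢ i<β)) (hi i<β β<K)

  here-facts : ∀ {st i s D} → i < K → st i ≡ s → AllFacts st D → Facts s i D
  here-facts i<K refl facts = facts i<K

  -- The tail from offset `3l + 1` is the tail from `3l + 4` preceded by three tokens. These must
  -- first form one mark, grown here a token at a time.
  grow-piece : ∀ i l x → i < K → l < K → 1 ≤ x → x ≤ 2 →
               Stage (At (OnBlock i (build (suc l) x))) (At (OnBlock i (build (suc l) (suc x)))) 2 (x + 1 + 2) 0
  grow-piece i l x i<K l<K 1≤x x≤2 = insert-stage i ω x 1 i<K ω<k 1≤x ≤-refl (fits ω x 1 i<K le) proj₁ OnBlock-upd
    (λ {st} {D} on facts singles → proj₂ (here-facts i<K (proj₁ on) facts) l refl ,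
      subst (λ y → enc (y ∷ []) ∈ D) (poly ω x (i * k)) (singles (below-M (ω + x) i<K ωx<k)))
    (λ r u → top {r} {ω + i * k + r} (subst (λ c → Up (build (suc l) x) c r (ω + i * k + r)) (role-rest l) u))
    (λ {c} → grow c)
    (subst (λ c → Up (build (suc l) (suc x)) c (x + 1) (ω + i * k + (x + 1))) (sym (role-rest l))
      (inj₂ (refl , ≤-reflexive (+-comm x 1))))
    λ { {D} (t , c) _ new → t , λ { l′ refl → subst (λ y → enc (iv (ω + i * k) y) ∈ D) (+-comm x 1) new } }
    where
    ω : ℕ
    ω = 1 + triple l
    le : ω + x + 1 ≤ k
    le = ≤-trans (+-monoˡ-≤ 1 (+-monoʳ-≤ ω x≤2)) (≤-trans (≤-reflexive (poly′ (triple l))) (≤-trans (+-monoʳ-≤ 1 (triple-mono l<K)) (n≤1+n _)))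
      where
      poly′ : ∀ y → 1 + y + 2 + 1 ≡ 1 + (3 + y)
      poly′ = solve-∀
    ωx<k : ω + x < k
    ωx<k = ≤-trans (≤-reflexive (+-comm 1 _)) le
    ω<k : ω < k
    ω<k = ≤-trans (s≤s (m≤m+n ω x)) ωx<k
    poly : ∀ y z u → y + z + u ≡ y + u + z
    poly = solve-∀
    top : ∀ {r e} → Up (build (suc l) x) (rest l) r e → r ≤ x ⊎ x + 1 < r
    top (inj₁ (l< , _)) = contradiction l< 1+n≰n
    top (inj₂ (_ , r≤)) = inj₁ r≤
    grow : ∀ c {r e} → Up (build (suc l) x) c r e → Up (build (suc l) (suc x)) c r e
    grow (rest _) (inj₁ u)        = inj₁ u
    grow (rest _) (inj₂ (e , r≤)) = inj₂ (e , ≤-trans r≤ (n≤1+n x))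

  prepend-piece : ∀ i l j → i < K → suc l + j ≡ K →
                  Stage (At (OnBlock i (build (suc l) 3))) (At (OnBlock i (build l 1))) 2 (3 + suc (triple j) + 2) 0
  prepend-piece i l j i<K lj≡ = insert-stage i ω 3 (suc (triple j)) i<K ω<k (s≤s z≤n) (s≤s z≤n)
    (fits ω 3 (suc (triple j)) i<K (≤-reflexive le)) proj₁ OnBlock-upd
    (λ {st} {D} on facts _ → let t , c = here-facts i<K (proj₁ on) facts in
      c l refl , subst (λ y → enc (iv y (suc (triple j))) ∈ D) (poly (triple l) (i * k)) (t (suc l) j lj≡ ≤-refl))
    (λ r u → top {r} {ω + i * k + r} (subst (λ c → Up (build (suc l) 3) c r (ω + i * k + r)) (role-rest l) u))
    (λ {c} → grow c)
    (subst (λ c → Up (build l 1) c (3 + suc (triple j)) (ω + i * k + (3 + suc (triple j)))) (sym (role-rest l))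
      (inj₁ (≤-refl , ≤-reflexive (trans (sym (+-assoc ω 3 (suc (triple j)))) le))))
    λ { (t , _) singles new →
        (λ l′ j′ e l≤ → tails t new l′ j′ e (m≤n⇒m<n∨m≡n l≤)) ,
        λ { l′ refl → singles (below-M (1 + triple l′) i<K (≤-trans (s≤s (s≤s (triple-mono (≤-trans (n≤1+n l′) (<⇒≤ l<K))))) ≤-refl)) } }
    where
    ω : ℕ
    ω = 1 + triple l
    l<K : l < K
    l<K = ≤-trans (m≤m+n (suc l) j) (≤-reflexive lj≡)
    le : ω + 3 + suc (triple j) ≡ k
    le = trans (poly′ (triple l) (triple j)) (sym (K-split {l} {j} lj≡))
      where
      poly′ : ∀ y z → 1 + y + 3 + suc z ≡ 5 + (y + z)
      poly′ = solve-∀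
    ω<k : ω < k
    ω<k = s≤s (s≤s (triple-mono (<⇒≤ l<K)))
    poly : ∀ y z → 4 + y + z ≡ 1 + y + z + 3
    poly = solve-∀
    top : ∀ {r e} → Up (build (suc l) 3) (rest l) r e → r ≤ 3 ⊎ 3 + suc (triple j) < r
    top (inj₁ (l< , _)) = contradiction l< 1+n≰n
    top (inj₂ (_ , r≤)) = inj₁ r≤
    grow : ∀ c {r e} → Up (build (suc l) 3) c r e → Up (build l 1) c r e
    grow (rest _) (inj₁ (l< , u))    = inj₁ (<⇒≤ l< , u)
    grow (rest _) (inj₂ (refl , r≤)) = inj₁ (≤-refl , ≤-trans (+-monoʳ-≤ ω r≤) (≤-trans (m≤m+n _ (suc (triple j))) (≤-reflexive le)))
    tails : ∀ {D} → Tails (suc l) i D → enc (iv (ω + i * k) (3 + suc (triple j))) ∈ D →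
            ∀ l′ j′ → l′ + j′ ≡ K → l < l′ ⊎ l ≡ l′ → tail-iv i l′ j′ ∈ D
    tails t new l′ j′ e (inj₁ l<)   = t l′ j′ e l<
    tails {D} t new l′ j′ e (inj₂ refl) = subst (λ y → tail-iv i l y ∈ D)
      (+-cancelˡ-≡ l (suc j) j′ (trans (+-suc l j) (trans lj≡ (sym e)))) new

  tails-stage : ∀ i → i < K → Stage (At (OnBlock i (build K 1))) (At (OnBlock i (build 0 1))) (K * 6) (K * (15 + triple K)) (K * 0)
  tails-stage i i<K = shift (λ x → x) (λ {n} {D} {prev} → subst (λ y → At (OnBlock i (build y 1)) n D prev) (n∸n≡0 K)) ≤-refl
    (iterate (λ j → At (OnBlock i (build (K ∸ j) 1))) K body)
    where
    body : ∀ j → j < K → Stage (At (OnBlock i (build (K ∸ j) 1))) (At (OnBlock i (build (K ∸ suc j) 1))) 6 (15 + triple K) 0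
    body j j<K = subst (λ y → Stage (At (OnBlock i (build y 1))) (At (OnBlock i (build l 1))) 6 (15 + triple K) 0) (sym K∸j≡)
      (shift (λ x → x) (λ x → x) len
        (grow-piece i l 1 i<K l<K ≤-refl (s≤s z≤n) ⨾ grow-piece i l 2 i<K l<K (s≤s z≤n) ≤-refl ⨾ prepend-piece i l j i<K lj≡))
      where
      l : ℕ
      l = K ∸ suc j
      lj≡ : suc l + j ≡ K
      lj≡ = trans (sym (+-suc l j)) (m∸n+n≡m j<K)
      l<K : l < K
      l<K = ≤-trans (m≤m+n (suc l) j) (≤-reflexive lj≡)
      K∸j≡ : K ∸ j ≡ suc l
      K∸j≡ = trans (cong (_∸ j) (sym lj≡)) (m+n∸n≡m (suc l) j)
      -- Two growth steps and the prepending, separators included: `4 + 5 + (6 + 3j)` tokens.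
      len : 1 + 1 + 2 + (2 + 1 + 2 + (3 + suc (triple j) + 2)) ≤ 15 + triple K
      len = ≤-trans (≤-reflexive (poly (triple j))) (+-monoʳ-≤ 15 (triple-mono (<⇒≤ j<K)))
        where
        poly : ∀ y → 1 + 1 + 2 + (2 + 1 + 2 + (3 + suc y + 2)) ≡ 15 + y
        poly = solve-∀

  past-end : ∀ {i γ r} → i + suc γ ≡ K → i * k + r ≡ W → k < r
  past-end {i} {γ} {r} e eq = ≤-trans (s≤s (m≤m+n k (γ * k))) (≤-reflexive (sym
    (+-cancelˡ-≡ (i * k) r (suc (suc γ * k)) (trans eq (trans (cong suc (split-at {i} e)) (sym (+-suc (i * k) _)))))))

  -- Joins the tail from offset 1 to the deep string of the next block, or to the single token
  -- `K · k` behind the last block. The result starts at offset 1, where no round begins a phrase.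
  deep-tail-stage : ∀ i γ → i + suc γ ≡ K → i < K →
                    Stage (At (OnBlock i (build 0 1))) (At (OnBlock i deep)) 2 (W + 2) 0
  deep-tail-stage i γ iγ≡ i<K = shift (λ x → x) (λ x → x) (+-monoˡ-≤ 2 len)
    (insert-stage i 1 (suc (triple K)) (suc (γ * k)) i<K (s≤s (s≤s z≤n)) (s≤s z≤n) (s≤s z≤n) (≤-reflexive end) proj₁ OnBlock-upd
      (λ {st} {D} on facts singles → proj₁ (here-facts i<K (proj₁ on) facts) 0 K refl z≤n ,
        subst (λ y → enc (iv y (suc (γ * k))) ∈ D) (poly′ (triple K) (i * k)) (next-deep on facts singles))
      (λ { r (inj₁ (_ , le)) → inj₁ (s≤s⁻¹ le) })
      (λ {c} → grow c)
      (inj₂ (trans (sym (+-assoc (1 + i * k) (suc (triple K)) (suc (γ * k)))) end))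
      λ { {D} (t , _) _ new → t , λ γ′ e → subst (λ y → enc (iv (suc (i * k)) (suc (triple K) + suc (y * k))) ∈ D)
            (suc-injective (+-cancelˡ-≡ i (suc γ) (suc γ′) (trans iγ≡ (sym e)))) new })
    where
    end : 1 + i * k + suc (triple K) + suc (γ * k) ≡ W
    end = trans (poly (i * k) (triple K) (γ * k)) (cong suc (sym (split-at {i} iγ≡)))
      where
      poly : ∀ x y z → 1 + x + suc y + suc z ≡ suc (x + (2 + y + z))
      poly = solve-∀
    len : suc (triple K) + suc (γ * k) ≤ W
    len = ≤-trans (m≤n+m _ (1 + i * k)) (≤-reflexive (trans (sym (+-assoc (1 + i * k) (suc (triple K)) (suc (γ * k)))) end))
    poly′ : ∀ y z → 2 + y + z ≡ 1 + z + suc y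
    poly′ = solve-∀
    grow : ∀ c {r e} → Up (build 0 1) c r e → Up deep c r e
    grow (rest _) (inj₁ (_ , u)) = inj₁ u
    next-deep : ∀ {st D} → OnBlock i (build 0 1) st → AllFacts st D → Singles D → enc (iv (suc i * k) (suc (γ * k))) ∈ D
    next-deep {st} {D} (_ , _ , hi) facts singles = go γ iγ≡
      where
      go : ∀ γ → i + suc γ ≡ K → enc (iv (suc i * k) (suc (γ * k))) ∈ D
      go zero e = singles (≤-trans (s≤s (≤-reflexive (cong (_* k) (trans (+-comm 1 i) e)))) W≤M)
      go (suc γ) e = proj₁ (proj₂ (here-facts si<K (hi ≤-refl si<K) facts)) (suc γ) (trans (sym (+-suc i (suc γ))) e)
        where
        si<K : suc i < K
        si<K = ≤-trans (s≤s (s≤s (m≤m+n i γ))) (≤-reflexive (trans (sym (trans (+-suc i (suc γ)) (cong suc (+-suc i γ)))) e))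

  deep-stage : ∀ i γ → i + suc γ ≡ K → i < K → Stage (At (OnBlock i deep)) (At (OnBlock i (live 0 0 1))) 2 (W + 2) 0
  deep-stage i γ iγ≡ i<K = shift (λ x → x) (λ x → x) (+-monoˡ-≤ 2 len)
    (insert-stage i 0 1 (suc (triple K) + suc (γ * k)) i<K (s≤s z≤n) ≤-refl (s≤s z≤n) (≤-reflexive end) proj₁ OnBlock-upd
      (λ {st} {D} on facts singles → singles (below-M 0 i<K (s≤s z≤n)) ,
        subst (λ y → enc (iv y (suc (triple K) + suc (γ * k))) ∈ D) (+-comm 1 (i * k))
          (proj₂ (here-facts i<K (proj₁ on) facts) γ iγ≡))
      -- Only short marks start at offset 0 so far, so the token there is read alone.
      (λ r ())
      (λ {c} → grow c)
      (inj₂ (trans (sym (+-assoc (i * k) 1 _)) end))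
      λ { {D} (t , _) singles new → t ,
          (λ γ′ e → subst (λ y → enc (iv (i * k) y) ∈ D)
            (trans (poly′ (triple K) (γ * k)) (cong (λ y → suc (y * k)) (+-cancelˡ-≡ i (suc γ) γ′ (trans iγ≡ (sym e))))) new) ,
          singles (below-M 0 i<K (s≤s z≤n)) })
    where
    end : i * k + 1 + (suc (triple K) + suc (γ * k)) ≡ W
    end = trans (poly (i * k) (triple K) (γ * k)) (cong suc (sym (split-at {i} iγ≡)))
      where
      poly : ∀ x y z → x + 1 + (suc y + suc z) ≡ suc (x + (2 + y + z))
      poly = solve-∀
    poly′ : ∀ y z → 1 + (suc y + suc z) ≡ suc (2 + y + z)
    poly′ = solve-∀
    len : 1 + (suc (triple K) + suc (γ * k)) ≤ W
    len = ≤-trans (m≤n+m _ (i * k)) (≤-reflexive (trans (sym (+-assoc (i * k) 1 _)) end))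
    grow : ∀ c {r e} → Up deep c r e → Up (live 0 0 1) c r e
    grow (rest _) u = inj₂ u

  -- The deep string does not interfere: it has more than `k` tokens, while only `y + 1 ≤ k` tokens
  -- precede the separator.
  grow-first : ∀ {P P′ : Layout → Set} i m y → i < K → 1 ≤ y → y < k →
               (∀ {st} → P st → st i ≡ live m m y) → (∀ {st} → P st → P′ (upd i (live m m (suc y)) st)) →
               Stage (At P) (At P′) 2 (y + 1 + 2) 0
  grow-first i m y i<K 1≤y y<k at P⇒ = insert-stage i 0 y 1 i<K (s≤s z≤n) 1≤y ≤-refl
    (fits 0 y 1 i<K (≤-trans (≤-reflexive (+-comm y 1)) y<k)) at P⇒
    (λ {st} {D} Pst facts singles → proj₂ (proj₂ (here-facts i<K (at Pst) facts)) ,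
      subst (λ x → enc (x ∷ []) ∈ D) (+-comm y (i * k)) (singles (below-M y i<K y<k)))
    top
    (λ {c} → grow c)
    (inj₁ (≤-reflexive (+-comm y 1)))
    λ { {D} (t , x , _) _ new → t , x , subst (λ r → enc (iv (i * k) r) ∈ D) (+-comm y 1) new }
    where
    top : ∀ r → r ≤ y ⊎ i * k + r ≡ W → r ≤ y ⊎ y + 1 < r
    top r (inj₁ r≤) = inj₁ r≤
    top r (inj₂ e)  = inj₂ (≤-<-trans (≤-trans (≤-reflexive (+-comm y 1)) y<k)
      (past-end {i} {K ∸ suc i} (trans (+-suc i _) (m+[n∸m]≡n i<K)) e))
    grow : ∀ c {r e} → Up (live m m y) c r e → Up (live m m (suc y)) c r e
    grow first      (inj₁ r≤) = inj₁ (≤-trans r≤ (n≤1+n y))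
    grow first      (inj₂ e)  = inj₂ e
    grow (rest _)   u = u
    grow (mid _)    u = u
    grow (single _) u = u

  block-stage : ∀ i γ → i + suc γ ≡ K →
                Stage (At (OnBlock i (build K 1))) (At (OnBlock i (live 0 0 2)))
                  (K * 6 + 6) (K * (15 + triple K) + ((W + 2) + ((W + 2) + 4))) (K * 0 + 0)
  block-stage i γ iγ≡ = tails-stage i i<K ⨾ deep-tail-stage i γ iγ≡ i<K ⨾ deep-stage i γ iγ≡ i<K ⨾
    grow-first i 0 1 i<K ≤-refl (s≤s (s≤s z≤n)) proj₁ OnBlock-upd
    where
    i<K : i < K
    i<K = ≤-trans (s≤s (m≤m+n i γ)) (≤-reflexive (trans (sym (+-suc i γ)) iγ≡))

  Suffix : ℕ → Layout → Set
  Suffix γ st = ∀ {β} → β < K → (β + γ < K → st β ≡ build K 1) × (K ≤ β + γ → st β ≡ live 0 0 2)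

  AllAre : Status → Layout → Set
  AllAre s st = ∀ {β} → β < K → st β ≡ s

  setup-stage : Stage (At (AllAre (build K 1))) (At (AllAre (live 0 0 2)))
                  (K * (K * 6 + 6)) (K * (K * (15 + triple K) + ((W + 2) + ((W + 2) + 4)))) (K * (K * 0 + 0))
  setup-stage = shift
    (λ (st , all , s) → st , (λ {β} β<K → (λ _ → all β<K) , λ K≤ → contradiction (≤-trans K≤ (≤-reflexive (+-identityʳ β))) (<⇒≱ β<K)) , s)
    (λ (st , suf , s) → st , (λ {β} β<K → proj₂ (suf β<K) (m≤n+m K β)) , s) ≤-refl
    (iterate (λ γ → At (Suffix γ)) K body)
    where
    body : ∀ γ → γ < K → Stage (At (Suffix γ)) (At (Suffix (suc γ))) (K * 6 + 6) (K * (15 + triple K) + ((W + 2) + ((W + 2) + 4))) (K * 0 + 0)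
    body γ γ<K = shift (λ (st , suf , s) → st , enter suf , s) (λ (st , on , s) → st , leave on , s) ≤-refl (block-stage i γ iγ≡)
      where
      i : ℕ
      i = K ∸ suc γ
      iγ≡ : i + suc γ ≡ K
      iγ≡ = m∸n+n≡m γ<K
      iγ≡′ : suc i + γ ≡ K
      iγ≡′ = trans (sym (+-suc i γ)) iγ≡
      i<K : i < K
      i<K = ≤-trans (m≤m+n (suc i) γ) (≤-reflexive iγ≡′)
      enter : ∀ {st} → Suffix γ st → OnBlock i (build K 1) st
      enter suf = proj₁ (suf i<K) (≤-reflexive iγ≡′) ,
        (λ β<i → proj₁ (suf (<-trans β<i i<K)) (≤-trans (+-monoˡ-≤ γ (≤-trans β<i (n≤1+n i))) (≤-reflexive iγ≡′))) ,
        λ i<β β<K → proj₂ (suf β<K) (≤-trans (≤-reflexive (sym iγ≡′)) (+-monoˡ-≤ γ i<β))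
      leave : ∀ {st} → OnBlock i (live 0 0 2) st → Suffix (suc γ) st
      leave {st} (at , lo , hi) {β} β<K with <-cmp β i
      ... | tri< β<i _ _ = (λ _ → lo β<i) , λ K≤ → contradiction K≤ (<⇒≱ (≤-trans (+-monoˡ-≤ (suc γ) β<i) (≤-reflexive iγ≡)))
      ... | tri≈ _ refl _ = (λ lt → contradiction iγ≡ (<⇒≢ lt)) , λ _ → at
      ... | tri> _ _ i<β = (λ lt → contradiction lt (≤⇒≯ (≤-trans (≤-reflexive (sym iγ≡)) (+-monoˡ-≤ (suc γ) (<⇒≤ i<β))))) , λ _ → hi i<β β<K

  -- The rounds

  Prefix : ℕ → Status → Status → Layout → Set
  Prefix i s s′ st = (∀ {β} → β < i → st β ≡ s′) × (∀ {β} → i ≤ β → β < K → st β ≡ s)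

  Prefix-upd : ∀ {i s s′ st} → Prefix i s s′ st → Prefix (suc i) s s′ (upd i s′ st)
  Prefix-upd {i} {s} {s′} {st} (lo , hi) = lo′ , λ i<β β<K → trans (upd-other (>⇒≢ i<β)) (hi (<⇒≤ i<β) β<K)
    where
    lo′ : ∀ {β} → β < suc i → upd i s′ st β ≡ s′
    lo′ (s≤s β≤i) with m≤n⇒m<n∨m≡n β≤i
    ... | inj₁ β<i  = trans (upd-other (<⇒≢ β<i)) (lo β<i)
    ... | inj₂ refl = upd-same i s′ st

  grow-all : ∀ m y → 1 ≤ y → y < k →
             Stage (At (AllAre (live m m y))) (At (AllAre (live m m (suc y)))) (K * 2) (K * (k + 2)) (K * 0)
  grow-all m y 1≤y y<k = shift
    (λ (st , all , s) → st , ((λ ()) , λ {β} _ β<K → all β<K) , s) (λ (st , pre , s) → st , (λ {β} β<K → proj₁ pre β<K) , s) ≤-refl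
    (iterate (λ i → At (Prefix i (live m m y) (live m m (suc y)))) K λ i i<K →
      shift (λ x → x) (λ x → x) (+-monoˡ-≤ 2 (≤-trans (≤-reflexive (+-comm y 1)) y<k))
        (grow-first i m y i<K 1≤y y<k (λ pre → proj₂ pre ≤-refl i<K) Prefix-upd))

  ready after : ℕ → Status
  ready m = live m m (2 + triple m)
  after m = live (suc m) (suc m) (3 + triple m)

  -- Within a pass the previous phrase is the last phrase of the block before. Its starting position
  -- is already spent and the layout permits any mark there, so the product LZMW forms across the
  -- block boundary is harmless.
  PassPrev : ℕ → ℕ → Layout → BStr → Set
  PassPrev n i st prev = Safe n prev ⊎ ∃[ x ] ∃[ r ] (prev ≡ enc (iv x r) × x + r ≡ i * k × (∀ s → U st x s))

  -- The credit with `j` blocks left: the search at each block start walks through all tokens up to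
  -- the end of the text, at least `H` letters apiece.
  gain : ℕ → ℕ
  gain zero    = 0
  gain (suc j) = suc j * k * H + gain j

  PassPrev-allowed : ∀ {n i st prev} y → W ≤ n → i * k + y ≤ W → PassPrev n i st prev →
                     Allowed n (U st) (prev ++ enc (iv (i * k) y))
  PassPrev-allowed {i = i} y W≤n le (inj₁ safe) = Allowed-∅ (safe ≤-refl (iv-< (i * k) y (≤-trans le W≤n)))
  PassPrev-allowed {i = i} y W≤n le (inj₂ (x , r , refl , end , free)) =
    inj₂ (iv x (r + y) , trans (cong (λ o → enc (iv x r) ++ enc (iv o y)) (sym end)) (sym (enc-iv-++ x r y)) ,
      iv-< x (r + y) (≤-trans (≤-reflexive (trans (sym (+-assoc x r y)) (cong (_+ y) end))) (≤-trans le W≤n)) ,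
      inj₂ (x , r + y , refl , free (r + y)))

  PassPrev-closed : ∀ {n i st prev} → W ≤ n → i ≤ K → PassPrev n i st prev → Allowed (suc n) (U st) (prev ++ enc (n ∷ []))
  PassPrev-closed W≤n i≤K (inj₁ safe) = Allowed-∅ (safe (n≤1+n _) (≤-refl ∷ []))
  PassPrev-closed W≤n i≤K (inj₂ (x , r , refl , end , _)) = closed-by-separator (iv x r) W≤n
    (iv-< x r (≤-trans (≤-reflexive end) (≤-trans (*-monoˡ-≤ k i≤K) (≤-trans (n≤1+n _) W≤n))))

  module Pass (n m u : ℕ) (W≤n : W ≤ n) (n<M : suc n < M) (mu≡ : suc m + u ≡ K) where

    y : ℕ
    y = 2 + triple m

    -- The status after two phrases of a block: the mark at the block start has grown, and `mid m`
    -- is released because LZMW is about to mark the second and third phrase together there.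
    -- `single m` is still to be read.
    halfway : Status
    halfway = live (suc m) m (suc y)

    k≡ : k ≡ 3 + y + triple u
    k≡ = K-split {m} {u} mu≡

    y+2<k : 2 + y < k
    y+2<k = ≤-trans (m≤m+n (3 + y) (triple u)) (≤-reflexive (sym k≡))

    to-halfway : ∀ c {r e} → Up (ready m) c r e → Up halfway c r e
    to-halfway first      (inj₁ r≤) = inj₁ (≤-trans r≤ (n≤1+n y))
    to-halfway first      (inj₂ e)  = inj₂ e
    to-halfway (rest _)   v = v
    to-halfway (mid _)    v = ≤-trans v (n≤1+n m)
    to-halfway (single _) v = v

    to-after : ∀ c {r e} → Up halfway c r e → Up (after m) c r e
    to-after first      v        = v
    to-after (rest _)   (inj₁ v) = inj₁ (≤-trans v (n≤1+n m))
    to-after (rest _)   (inj₂ v) = inj₂ v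
    to-after (mid _)    v = v
    to-after (single _) v = ≤-trans v (n≤1+n m)

    U⇒Up : ∀ {st s c ω i r} → st i ≡ s → ω < k → role ω ≡ c → U st (ω + i * k) r → Up s c r (ω + i * k + r)
    U⇒Up {st} {i = i} {r} refl ω<k refl v = subst (λ X → X) (U-at st i r ω<k) v

    Up⇒U : ∀ {st s c ω i r} → st i ≡ s → ω < k → role ω ≡ c → Up s c r (ω + i * k + r) → U st (ω + i * k) r
    Up⇒U {st} {i = i} {r} refl ω<k refl v = subst (λ X → X) (sym (U-at st i r ω<k)) v

    -- Induction on the blocks left. The first `pair-step` reads offsets `[0, y)` and `[y]` and
    -- earns the credit; the second reads `[y + 1]` and `[y + 2, k)`, bringing the parse to the next
    -- block start.
    sweep : ∀ {w τ} → (∀ {D prev} → At (AllAre (after m)) (2 + n) D prev → Slow D prev w τ) →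
            ∀ j {i st D prev} → i + j ≡ K → Core n (U st) D → AllFacts st D → Prefix i (ready m) (after m) st →
            PassPrev n i st prev → Slow D prev (enc (iv (i * k) (j * k)) ++ code n ++ enc (suc n ∷ []) ++ w) (gain j + τ)
    sweep {w} {τ} κ zero {i} {st} {D} {prev} i≡ core facts (done , _) pv =
      subst (λ x → Slow D prev x τ) (++-assoc (code n) (enc (suc n ∷ [])) w)
        (separate core W≤n n<M (PassPrev-closed {i = i} {st} W≤n (≤-reflexive i≡K) pv) λ D⊆ core′ safe′ →
          κ (st , (λ {β} β<K → done (≤-trans β<K (≤-reflexive (sym i≡K)))) , record
            { core = core′ ; facts = λ {β} β<K → Facts-mono (st β) β D⊆ (facts β<K) ; safe = safe′ }))
      where
      i≡K : i ≡ K
      i≡K = trans (sym (+-identityʳ i)) i≡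
    sweep {w} {τ} κ (suc j) {i} {st} {D} {prev} i≡ core facts pre pv =
      subst (Slow D prev text) (sym (+-assoc (suc j * k * H) (gain j) τ))
        (pair-step {U′ = U st₁} {x = i * k} {x₁ = y + i * k} {x₂ = suc y + i * k} {m = y} {l = 1} {r = r₁}
          core W≤n (s≤s z≤n) ≤-refl (+-comm y (i * k)) (sym (+-comm (y + i * k) 1)) (≤-trans (≤-reflexive end₁) (n≤1+n _))
          text≡
          (proj₂ (proj₂ hereF)) (Core.singles core (below-M y i<K (≤-trans (n≤1+n _) (≤-trans (n≤1+n _) y+2<k))))
          top₁ top₂ (PassPrev-allowed {i = i} {st} y W≤n le pv) (U-upd {st} {i} at (λ {c} → to-halfway c))
          (Up⇒U {st₁} {ω = 0} {i} at₁ (s≤s z≤n) refl (inj₁ (≤-reflexive (+-comm y 1))))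
          deep-match
          λ {D₁} D⊆₁ new₁ core₁ →
            pair-step {U′ = U st₂} {x = suc y + i * k} {x₁ = 2 + y + i * k} {x₂ = suc i * k} {m = 1} {l = suc (triple u)} {r = j * k}
              core₁ W≤n ≤-refl (s≤s z≤n) (sym (+-comm (suc y + i * k) 1)) k-end (≤-trans (≤-reflexive end₂) (n≤1+n _))
              text₁≡
              (Core.singles core₁ (below-M (suc y) i<K (≤-trans (n≤1+n _) y+2<k)))
              (D⊆₁ (proj₁ hereF (suc m) u mu≡ z≤n))
              top₃ top₄ allowed₁ (U-upd {st₁} {i} at₁ (λ {c} → to-after c))
              (Up⇒U {st₂} {c = single m} {ω = suc y} {i} at₂ (≤-trans (n≤1+n _) y+2<k) (role-single m) ≤-refl)
              z≤n
              λ {D₂} D⊆₂ new₂ core₂ →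
                sweep κ j {suc i} {st₂} (trans (sym (+-suc i j)) i≡) core₂
                  (AllFacts-upd D⊆₂ (AllFacts-upd D⊆₁ facts (facts₁ (Facts-mono (ready m) i D⊆₁ hereF) new₁))
                    (Facts-mono halfway i D⊆₂ (facts₁ (Facts-mono (ready m) i D⊆₁ hereF) new₁)))
                  prefix₂
                  (inj₂ (2 + y + i * k , suc (triple u) , refl , sym k-end ,
                    λ s → Up⇒U {st₂} {c = rest (suc m)} {ω = 2 + y} {i} at₂ y+2<k (role-rest (suc m)) (inj₁ ≤-refl))))
      where
      st₁ st₂ : Layout
      st₁ = upd i halfway st
      st₂ = upd i (after m) st₁
      text z : BStr
      z = enc (suc n ∷ []) ++ w
      text = enc (iv (i * k) (suc j * k)) ++ code n ++ z
      r₁ : ℕ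
      r₁ = 1 + (suc (triple u) + j * k)
      i<K : i < K
      i<K = ≤-trans (s≤s (m≤m+n i j)) (≤-reflexive (trans (sym (+-suc i j)) i≡))
      at : st i ≡ ready m
      at = proj₂ pre ≤-refl i<K
      at₁ : st₁ i ≡ halfway
      at₁ = upd-same i halfway st
      at₂ : st₂ i ≡ after m
      at₂ = upd-same i (after m) st₁
      hereF : Facts (ready m) i D
      hereF = here-facts {st} i<K at facts
      facts₁ : ∀ {D} → Facts (ready m) i D → enc (iv (i * k) (y + 1)) ∈ D → Facts halfway i D
      facts₁ {D} (t , x , _) new = t , x , subst (λ r → enc (iv (i * k) r) ∈ D) (+-comm y 1) new
      prefix₂ : Prefix (suc i) (ready m) (after m) st₂
      prefix₂ = (λ {β} β≤ → lo β (m≤n⇒m<n∨m≡n (s≤s⁻¹ β≤))) , λ {β} i<β β<K →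
        trans (upd-other (>⇒≢ i<β)) (trans (upd-other (>⇒≢ i<β)) (proj₂ pre (<⇒≤ i<β) β<K))
        where
        lo : ∀ β → β < i ⊎ β ≡ i → st₂ β ≡ after m
        lo β (inj₁ β<i)  = trans (upd-other (<⇒≢ β<i)) (trans (upd-other (<⇒≢ β<i)) (proj₁ pre β<i))
        lo β (inj₂ refl) = at₂
      k-end : suc i * k ≡ 2 + y + i * k + suc (triple u)
      k-end = trans (cong (_+ i * k) k≡) (poly y (triple u) (i * k))
        where
        poly : ∀ x v o → 3 + x + v + o ≡ 2 + x + o + suc v
        poly = solve-∀
      end₂ : suc i * k + j * k ≡ K * k
      end₂ = sym (split-at {suc i} {j} (trans (sym (+-suc i j)) i≡))
      end₁ : suc y + i * k + r₁ ≡ K * k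
      end₁ = trans (poly (y + i * k) (triple u) (j * k)) (trans (cong (_+ j * k) (sym k-end)) end₂)
        where
        poly : ∀ x v o → suc x + (1 + (suc v + o)) ≡ 2 + x + suc v + o
        poly = solve-∀
      le : i * k + y ≤ W
      le = ≤-trans (≤-trans (≤-reflexive (+-comm (i * k) y)) (≤-trans (n≤1+n _) (m≤m+n (suc y + i * k) r₁)))
                   (≤-trans (≤-reflexive end₁) (n≤1+n _))
      -- The data tokens of the text end at `K · k`, the deep strings one token later at `W`; this
      -- one token keeps them from matching completely.
      beyond : ∀ {x r s} → x + r ≡ K * k → x + s ≡ W → r < s
      beyond {x} {r} {s} e e′ = ≤-reflexive (+-cancelˡ-≡ x (suc r) s (trans (+-suc x r) (trans (cong suc e) (sym e′))))
      top₁ : ∀ s → U st (i * k) s → s ≤ y ⊎ y + (1 + r₁) < s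
      top₁ s v with U⇒Up {st} {ω = 0} {i} at (s≤s z≤n) refl v
      ... | inj₁ s≤ = inj₁ s≤
      ... | inj₂ e  = inj₂ (beyond {i * k} (trans (poly (i * k) y r₁) end₁) e)
        where
        poly : ∀ x v o → x + (v + (1 + o)) ≡ suc v + x + o
        poly = solve-∀
      top₂ : ∀ s → U st (y + i * k) s → s ≤ 1 ⊎ 1 + r₁ < s
      top₂ s v = contradiction (U⇒Up {st} {c = mid m} {ω = y} {i} {s} at (≤-trans (n≤1+n _) (≤-trans (n≤1+n _) y+2<k)) (role-mid m) v) 1+n≰n
      top₃ : ∀ s → U st₁ (suc y + i * k) s → s ≤ 1 ⊎ 1 + (suc (triple u) + j * k) < s
      top₃ s v = contradiction (U⇒Up {st₁} {c = single m} {ω = suc y} {i} {s} at₁ (≤-trans (n≤1+n _) y+2<k) (role-single m) v) 1+n≰n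
      top₄ : ∀ s → U st₁ (2 + y + i * k) s → s ≤ suc (triple u) ⊎ suc (triple u) + j * k < s
      top₄ s v with U⇒Up {st₁} {c = rest (suc m)} {ω = 2 + y} {i} at₁ y+2<k (role-rest (suc m)) v
      ... | inj₁ m<m = contradiction m<m 1+n≰n
      ... | inj₂ (inj₁ s≤) = inj₁ (+-cancelˡ-≤ (2 + y) s (suc (triple u)) (≤-trans s≤ (≤-reflexive (trans k≡ (sym (+-suc (2 + y) (triple u)))))))
      ... | inj₂ (inj₂ e)  = inj₂ (beyond {2 + y + i * k} (trans (sym (+-assoc (2 + y + i * k) (suc (triple u)) (j * k)))
                               (trans (cong (_+ j * k) (sym k-end)) end₂)) e)
      allowed₁ : Allowed n (U st₁) (enc (iv (y + i * k) 1) ++ enc (iv (suc y + i * k) 1))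
      allowed₁ = inj₂ (iv (y + i * k) 2 , sym (enc-++ (iv (y + i * k) 1) (iv (suc y + i * k) 1)) ,
        iv-< (y + i * k) 2 (≤-trans (≤-trans (≤-reflexive (poly (y + i * k))) (≤-trans (+-monoʳ-≤ (suc y + i * k) (s≤s z≤n)) (≤-reflexive end₁))) (≤-trans (n≤1+n _) W≤n)) ,
        inj₂ (y + i * k , 2 , refl , Up⇒U {st₁} {c = mid m} {ω = y} {i} {2} at₁ (≤-trans (n≤1+n _) (≤-trans (n≤1+n _) y+2<k)) (role-mid m) ≤-refl))
        where
        poly : ∀ x → x + 2 ≡ suc x + 1
        poly = solve-∀
      iv-block : ∀ {x x′ l r} → x′ ≡ x + l → enc (iv x (l + r)) ++ code n ++ z ≡ enc (iv x l) ++ enc (iv x′ r) ++ code n ++ z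
      iv-block {x} {l = l} {r} refl = trans (cong (_++ code n ++ z) (enc-iv-++ x l r)) (++-assoc (enc (iv x l)) _ _)
      text₁≡ : enc (iv (suc y + i * k) r₁) ++ code n ++ z ≡
               enc (iv (suc y + i * k) 1) ++ enc (iv (2 + y + i * k) (suc (triple u))) ++ enc (iv (suc i * k) (j * k)) ++ code n ++ z
      text₁≡ = trans (iv-block {suc y + i * k} {2 + y + i * k} {1} {suc (triple u) + j * k} (sym (+-comm (suc y + i * k) 1)))
        (cong (enc (iv (suc y + i * k) 1) ++_) (iv-block {2 + y + i * k} {suc i * k} {suc (triple u)} {j * k} k-end))
      text≡ : text ≡ enc (iv (i * k) y) ++ enc (iv (y + i * k) 1) ++ enc (iv (suc y + i * k) r₁) ++ code n ++ z
      text≡ = trans (cong (λ s → enc (iv (i * k) s) ++ code n ++ z) (trans (cong (_+ j * k) k≡) (poly y (triple u) (j * k))))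
        (trans (iv-block {i * k} {y + i * k} {y} {1 + r₁} (+-comm y (i * k)))
          (cong (enc (iv (i * k) y) ++_) (iv-block {y + i * k} {suc y + i * k} {1} {r₁} (sym (+-comm (y + i * k) 1)))))
        where
        poly : ∀ x v o → 3 + x + v + o ≡ x + (1 + (1 + (suc v + o)))
        poly = solve-∀
      deep-match : suc j * k * H ≤ trieMatch D text
      deep-match = begin
        suc j * k * H                                        ≡⟨ cong (_* H) (length-iv (i * k) (suc j * k)) ⟨
        length (iv (i * k) (suc j * k)) * H                  ≤⟨ length-enc-≥ (iv (i * k) (suc j * k)) ⟩
        length (enc (iv (i * k) (suc j * k)))                ≤⟨ length≤lcp (enc (iv (i * k) (suc j * k))) ⟩
        lcp (enc (iv (i * k) (suc j * k)) ++ enc (iv (i * k + suc j * k) 1)) text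
                                                             ≤⟨ lcp≤trieMatch D text stored ⟩
        trieMatch D text                                     ∎
        where
        open ≤-Reasoning
        stored : enc (iv (i * k) (suc j * k)) ++ enc (iv (i * k + suc j * k) 1) ∈ D
        stored = subst (_∈ D) (trans (cong (λ s → enc (iv (i * k) s)) (+-comm 1 (suc j * k))) (enc-iv-++ (i * k) (suc j * k) 1))
                   (proj₁ (proj₂ hereF) (suc j) i≡)

  pass-stage : ∀ m → m < K → Stage (At (AllAre (ready m))) (At (AllAre (after m))) 2 (K * k + 2) (gain K)
  Stage.perform (pass-stage m m<K) n W≤n n≤M = enc text , length-text , go
    where
    n<M : suc n < M
    n<M = ≤-trans (≤-reflexive (+-comm 2 n)) n≤M
    text : List ℕ
    text = iv 0 (K * k) ++ n ∷ suc n ∷ []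
    length-text : length (enc text) ≤ (K * k + 2) * C
    length-text = ≤-trans
      (length-enc-≤ (All-++⁺ (iv-< 0 (K * k) (≤-trans (n≤1+n _) W≤M)) (<⇒≤ n<M ∷ n<M ∷ [])))
      (≤-reflexive (cong (_* C) (trans (length-++ (iv 0 (K * k))) (cong (_+ 2) (length-iv 0 (K * k))))))
    go : ∀ {w τ} → (∀ {D prev} → At (AllAre (after m)) (n + 2) D prev → Slow D prev w τ) →
         ∀ {D prev} → At (AllAre (ready m)) n D prev → Slow D prev (enc text ++ w) (gain K + τ)
    go {w} {τ} κ {D} {prev} (st , all , state) = subst (λ x → Slow D prev x (gain K + τ)) (sym split)
      (Pass.sweep n m (K ∸ suc m) W≤n n<M (m+[n∸m]≡n m<K)
        (λ {D} {prev} p → κ (subst (λ x → At (AllAre (after m)) x D prev) (+-comm 2 n) p))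
        K {0} {st} refl (State.core state) (State.facts state) ((λ ()) , λ {β} _ β<K → all β<K) (inj₁ (State.safe state)))
      where
      split : enc text ++ w ≡ enc (iv 0 (K * k)) ++ code n ++ enc (suc n ∷ []) ++ w
      split = trans (cong (_++ w) (enc-++ (iv 0 (K * k)) _))
        (trans (++-assoc (enc (iv 0 (K * k))) _ w) (cong (enc (iv 0 (K * k)) ++_) (++-assoc (code n) _ w)))

  -- The pass lengthens the mark at each block start from `3m + 2` to `3m + 3`; the next round needs
  -- `3m + 5`, hence one insertion per missing token.
  round-stage : ∀ m → m < K → Stage (At (AllAre (ready m))) (At (AllAre (ready (suc m))))
                  (2 + (K * 2 + K * 2)) ((K * k + 2) + (K * (k + 2) + K * (k + 2))) (gain K + (K * 0 + K * 0))
  round-stage m m<K = pass-stage m m<K ⨾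
    grow-all (suc m) (3 + triple m) (s≤s z≤n) (≤-trans (n≤1+n _) y<k) ⨾ grow-all (suc m) (4 + triple m) (s≤s z≤n) y<k
    where
    y<k : 4 + triple m < k
    y<k = s≤s (s≤s (triple-mono m<K))

  δ-total ℓ-total g-total : ℕ
  δ-total = K * (K * 6 + 6) + K * (2 + (K * 2 + K * 2))
  ℓ-total = K * (K * (15 + triple K) + ((W + 2) + ((W + 2) + 4))) + K * ((K * k + 2) + (K * (k + 2) + K * (k + 2)))
  g-total = K * (K * 0 + 0) + K * (gain K + (K * 0 + K * 0))

  whole-stage : Stage (At (AllAre (build K 1))) (At (AllAre (ready K))) δ-total ℓ-total g-total
  whole-stage = setup-stage ⨾ iterate (λ m → At (AllAre (ready m))) K round-stage

-- Counting tokens, letters and comparisons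

module Bounds (alg : Algorithm) (x H : ℕ) .{{_ : NonZero H}} (H≡ : H ≡ 5 * suc x)
              (W≤M : suc (suc x * (2 + triple (suc x))) ≤ Codes.M alg H) where
  open Algorithm alg
  open Codes alg H
  K : ℕ
  K = suc x
  open Blocks alg K H W≤M
  open Intervals alg H W W≤M hiding (pair-step)
  open Rounds alg K H W≤M

  -- Under `build K 1` all required tails and pieces are single tokens, which the coding phase has
  -- marked.
  initial : ∀ {D prev} → Coded D prev → At (AllAre (build K 1)) W D prev
  initial {D} coded = (λ _ → build K 1) , (λ _ → refl) , record
    { core = record { marks = λ d∈ → inj₁ (short d∈) ; singles = singles }
    ; facts = λ {β} β<K →
        (λ l j e K≤l → subst (λ y → enc (iv (1 + triple l + β * k) (suc (triple y))) ∈ D) (sym (j≡0 l j e K≤l))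
          (singles (below-M (1 + triple l) β<K (s≤s (s≤s (triple-mono (≤-trans (m≤m+n l j) (≤-reflexive e)))))))) ,
        λ l e → singles (below-M (1 + triple l) β<K (s≤s (s≤s (triple-mono (≤-trans (n≤1+n l) (≤-reflexive e))))))
    ; safe = λ _ _ → inj₁ (prev-short _) }
    where
    open Coded coded using (short; prev-short) renaming (codes to all-codes)
    singles : Singles D
    singles {t} t<M = subst (_∈ D) (sym (++-identityʳ (code t))) (all-codes t<M)
    j≡0 : ∀ l j → l + j ≡ K → K ≤ l → j ≡ 0
    j≡0 l j e K≤l = n≤0⇒n≡0 (+-cancelˡ-≤ l j 0 (≤-trans (≤-reflexive e) (≤-trans K≤l (≤-reflexive (sym (+-identityʳ l))))))

  -- Data tokens and separators number `13K² + 10K + 1`. The factor 5 in `H = 5K` is the least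
  -- integer for which `H²` suffices for every `K ≥ 1`.
  budget : W + δ-total ≤ M
  budget = ≤-trans (m≤m+n _ (1 + 14 * x + 12 * (x * x))) (≤-reflexive (begin
    W + δ-total + (1 + 14 * x + 12 * (x * x))   ≡⟨ cong (λ t → suc (K * (2 + t)) + δ-total + (1 + 14 * x + 12 * (x * x))) (triple≡3* K) ⟩
    suc (K * (2 + 3 * K)) + δ-total + (1 + 14 * x + 12 * (x * x)) ≡⟨ poly x ⟩
    5 * K * (5 * K)                             ≡⟨ cong₂ _*_ H≡ H≡ ⟨
    M                                           ∎))
    where
    open ≡-Reasoning
    poly : ∀ x → suc (suc x * (2 + 3 * suc x)) + (suc x * (suc x * 6 + 6) + suc x * (2 + (suc x * 2 + suc x * 2))) +
                 (1 + 14 * x + 12 * (x * x)) ≡ 5 * suc x * (5 * suc x)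
    poly = solve-∀

  rounds : ∃[ text ] (length text ≤ ℓ-total * C ×
             (∀ {w τ} → (∀ {D prev} → At (AllAre (ready K)) (W + δ-total) D prev → Slow D prev w τ) →
               ∀ {D prev} → At (AllAre (build K 1)) W D prev → Slow D prev (text ++ w) (g-total + τ)))
  rounds = Stage.perform whole-stage W ≤-refl budget

  input : BStr
  input = codeText ++ proj₁ rounds ++ []

  g-total≤time : g-total ≤ time input
  g-total≤time = ≤-trans (≤-reflexive (sym (+-identityʳ g-total)))
    (coding λ coded → proj₂ (proj₂ rounds) {[]} {0} (λ _ → stop) (initial coded))

  length-pairText : ∀ t j → t + j ≡ M → length (pairText t j) ≤ suc j * C
  length-pairText t zero e = begin
    length (unit (p t) ++ unit Z)               ≡⟨ length-++ (unit (p t)) ⟩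
    length (unit (p t)) + length (unit Z)       ≤⟨ +-mono-≤ (length-unit (p t)) (length-unit Z) ⟩
    (2 + p t) + (2 + Z)                         ≤⟨ +-monoˡ-≤ (2 + Z) (+-monoʳ-≤ 2 (p≤ (≤-reflexive (trans (sym (+-identityʳ t)) e)))) ⟩
    (2 + suc H) + (2 + Z)                       ≡⟨ poly H ⟩
    1 * C                                       ∎
    where
    open ≤-Reasoning
    poly : ∀ x → (2 + suc x) + (2 + (2 + (x + x))) ≡ 1 * (7 + 3 * x)
    poly = solve-∀
  length-pairText t (suc j) e = ≤-trans (≤-reflexive (length-++ (code t)))
    (+-mono-≤ (length-code-≤ (≤-trans (m≤m+n (suc t) j) (≤-reflexive e′))) (length-pairText (suc t) j e′))
    where
    e′ : suc t + j ≡ M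
    e′ = trans (sym (+-suc t j)) e

  length-input : length input ≤ 2 + (suc Z * (2 + suc Z) + suc M * C + ℓ-total * C)
  length-input = begin
    length input                                                   ≡⟨ cong length (cong (codeText ++_) (++-identityʳ (proj₁ rounds))) ⟩
    length (codeText ++ proj₁ rounds)                              ≡⟨ length-++ codeText ⟩
    length codeText + length (proj₁ rounds)                        ≡⟨ cong (λ y → 2 + y + length (proj₁ rounds)) (length-++ (chainText 0 (suc Z))) ⟩
    2 + (length (chainText 0 (suc Z)) + length (pairText 0 M)) + length (proj₁ rounds)
      ≤⟨ +-mono-≤ (+-monoʳ-≤ 2 (+-mono-≤ (length-chainText 0 (suc Z)) (length-pairText 0 M refl))) (proj₁ (proj₂ rounds)) ⟩
    2 + (suc Z * (2 + suc Z) + suc M * C + ℓ-total * C)            ∎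
    where open ≤-Reasoning

  -- With `K = x + 1`, 2067 is the value at `x = 0` of the bound in `length-input`, and `slack` is
  -- its distance from `2067 K⁴`, a polynomial in `x` without negative coefficients.
  length-input-≤ : length input ≤ 2067 * K ^ 4
  length-input-≤ = ≤-trans length-input (≤-trans (m≤m+n _ slack) (≤-reflexive (trans
    (cong₂ (λ h t → 2 + (suc (2 + (h + h)) * (2 + suc (2 + (h + h))) + suc (h * h) * (7 + 3 * h) + ℓ t * (7 + 3 * h)) + slack) {u = triple K} {v = 3 * K} H≡ (triple≡3* K))
    (poly x))))
    where
    slack : ℕ
    slack = 2885 * x + 7316 * (x * x) + 6252 * (x * x * x) + 1797 * (x * x * x * x)
    ℓ : ℕ → ℕ
    ℓ t = K * (K * (15 + t) + ((suc (K * (2 + t)) + 2) + ((suc (K * (2 + t)) + 2) + 4))) +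
          K * ((K * (2 + t) + 2) + (K * (2 + t + 2) + K * (2 + t + 2)))
    poly : ∀ x →
      2 + (suc (2 + (5 * suc x + 5 * suc x)) * (2 + suc (2 + (5 * suc x + 5 * suc x))) +
           suc (5 * suc x * (5 * suc x)) * (7 + 3 * (5 * suc x)) +
           (suc x * (suc x * (15 + 3 * suc x) + ((suc (suc x * (2 + 3 * suc x)) + 2) + ((suc (suc x * (2 + 3 * suc x)) + 2) + 4))) +
            suc x * ((suc x * (2 + 3 * suc x) + 2) + (suc x * (2 + 3 * suc x + 2) + suc x * (2 + 3 * suc x + 2)))) *
           (7 + 3 * (5 * suc x))) +
      (2885 * x + 7316 * (x * x) + 6252 * (x * x * x) + 1797 * (x * x * x * x))
      ≡ 2067 * (suc x * (suc x * (suc x * (suc x * 1))))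
    poly = solve-∀

  K≤length-input : K ≤ length input
  K≤length-input = begin
    K                                              ≤⟨ m≤m+n K (4 * K) ⟩
    5 * K                                          ≡⟨ H≡ ⟨
    H                                              ≤⟨ ≤-trans (m≤m+n H H) (m≤n+m (H + H) 3) ⟩
    suc Z                                          ≤⟨ chain≥ 0 (suc Z) ⟩
    length (chainText 0 (suc Z))                   ≤⟨ m≤m+n _ (length (pairText 0 M)) ⟩
    length (chainText 0 (suc Z)) + length (pairText 0 M) ≡⟨ length-++ (chainText 0 (suc Z)) ⟨
    length (chainText 0 (suc Z) ++ pairText 0 M)   ≤⟨ m≤n+m _ 2 ⟩
    length codeText                                ≤⟨ m≤m+n _ (length (proj₁ rounds ++ [])) ⟩
    length codeText + length (proj₁ rounds ++ [])  ≡⟨ length-++ codeText ⟨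
    length input                                   ∎
    where
    open ≤-Reasoning
    chain≥ : ∀ i j → j ≤ length (chainText i j)
    chain≥ i zero    = z≤n
    chain≥ i (suc j) = s≤s (≤-trans (chain≥ (suc i) j) (≤-trans (m≤n+m _ (length (run (suc i) []))) (≤-reflexive (sym (length-++ (run (suc i) []))))))

  -- `gain j` is `k H` times the triangular number `j (j + 1) / 2`.
  gain-≥ : ∀ j → j * j * (k * H) ≤ 2 * gain j
  gain-≥ zero    = z≤n
  gain-≥ (suc j) = begin
    suc j * suc j * (k * H)                            ≤⟨ m≤m+n _ (k * H) ⟩
    suc j * suc j * (k * H) + k * H                    ≡⟨ poly j k H ⟩
    2 * (suc j * k * H) + j * j * (k * H)              ≤⟨ +-monoʳ-≤ (2 * (suc j * k * H)) (gain-≥ j) ⟩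
    2 * (suc j * k * H) + 2 * gain j                   ≡⟨ *-distribˡ-+ 2 (suc j * k * H) (gain j) ⟨
    2 * gain (suc j)                                   ∎
    where
    open ≤-Reasoning
    poly : ∀ j k h → suc j * suc j * (k * h) + k * h ≡ 2 * (suc j * k * h) + j * j * (k * h)
    poly = solve-∀

  K^5≤time : K ^ 5 ≤ time input
  K^5≤time = ≤-trans (*-cancelˡ-≤ 2 (begin
    2 * K ^ 5                            ≡⟨ poly K ⟩
    K * (K * K * (2 * K * K))            ≤⟨ *-monoʳ-≤ K (*-monoʳ-≤ (K * K) kH≥) ⟩
    K * (K * K * (k * H))                ≤⟨ *-monoʳ-≤ K (gain-≥ K) ⟩
    K * (2 * gain K)                     ≡⟨ poly′ K (gain K) ⟩
    2 * (K * gain K)                     ≤⟨ *-monoʳ-≤ 2 (≤-trans (*-monoʳ-≤ K (m≤m+n (gain K) _)) (m≤n+m _ (K * (K * 0 + 0)))) ⟩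
    2 * g-total                          ∎)) g-total≤time
    where
    open ≤-Reasoning
    poly : ∀ y → 2 * (y * (y * (y * (y * (y * 1))))) ≡ y * (y * y * (2 * y * y))
    poly = solve-∀
    poly′ : ∀ y g → y * (2 * g) ≡ 2 * (y * g)
    poly′ = solve-∀
    kH≥ : 2 * K * K ≤ k * H
    kH≥ = *-mono-≤ (≤-trans (*-monoˡ-≤ K (s≤s (s≤s (z≤n {1})))) (≤-trans (≤-reflexive (sym (triple≡3* K))) (m≤n+m (triple K) 2)))
                   (≤-trans (m≤m+n K (4 * K)) (≤-reflexive (sym H≡)))

slow-inputs : ∀ alg x → ∃[ s ] (suc x ≤ length s × 2 ≤ length s × length s ≤ 2067 * suc x ^ 4 × suc x ^ 5 ≤ Algorithm.time alg s)
slow-inputs alg x = go (5 * suc x) refl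
  where
  go : ∀ H → H ≡ 5 * suc x → ∃[ s ] (suc x ≤ length s × 2 ≤ length s × length s ≤ 2067 * suc x ^ 4 × suc x ^ 5 ≤ Algorithm.time alg s)
  go H@(suc _) H≡ = input , K≤length-input , s≤s (s≤s z≤n) , length-input-≤ , K^5≤time
    where
    poly : ∀ x → suc (suc x * (2 + 3 * suc x)) + (19 + 42 * x + 22 * (x * x)) ≡ 5 * suc x * (5 * suc x)
    poly = solve-∀
    W≤M : suc (suc x * (2 + triple (suc x))) ≤ Codes.M alg H
    W≤M = ≤-trans (≤-reflexive (cong (λ t → suc (suc x * (2 + t))) (triple≡3* (suc x))))
      (≤-trans (m≤m+n _ _) (≤-reflexive (trans (poly x) (sym (cong₂ _*_ H≡ H≡)))))
    open Bounds alg x H H≡ W≤M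

-- The two estimates meet at `K²⁰`: `n⁵ ≤ A⁵ K²⁰ ≤ A⁵ T⁴` with `A = 2067`. Length at least 2 makes
-- the logarithm at least 1.
superlinear : ∀ alg → ∃[ c ] (1 ≤ c × (∀ N → ∃[ n ] (N ≤ n × ∃[ s ] (length s ≡ n × n ^ 5 ≤ c * (Algorithm.time alg s ^ 4 * ⌊log₂ n ⌋)))))
superlinear alg = 2067 ^ 5 , m^n>0 2067 5 , λ N →
  let s , K≤ , 2≤ , ≤K^4 , K^5≤ = slow-inputs alg N
  in length s , ≤-trans (n≤1+n N) K≤ , s , refl , bound (length s) (suc N) (Algorithm.time alg s) 2067 ≤K^4 K^5≤ (⌊log₂⌋-mono-≤ 2≤)
  where
  open ≤-Reasoning
  bound : ∀ n K T A {l} → n ≤ A * K ^ 4 → K ^ 5 ≤ T → 1 ≤ l → n ^ 5 ≤ A ^ 5 * (T ^ 4 * l)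
  bound n K T A {l} n≤ ≤T 1≤l = begin
    n ^ 5                      ≤⟨ ^-monoˡ-≤ 5 n≤ ⟩
    (A * K ^ 4) ^ 5            ≡⟨ poly A (K ^ 4) ⟩
    A ^ 5 * ((K ^ 4) ^ 5 * 1)  ≡⟨ cong (λ y → A ^ 5 * (y * 1)) (trans (^-*-assoc K 4 5) (sym (^-*-assoc K 5 4))) ⟩
    A ^ 5 * ((K ^ 5) ^ 4 * 1)  ≤⟨ *-monoʳ-≤ (A ^ 5) (*-mono-≤ (^-monoˡ-≤ 4 ≤T) 1≤l) ⟩
    A ^ 5 * (T ^ 4 * l)        ∎
    where
    poly : ∀ A y → A * y * (A * y * (A * y * (A * y * (A * y * 1)))) ≡
                   A * (A * (A * (A * (A * 1)))) * (y * (y * (y * (y * (y * 1)))) * 1)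
    poly = solve-∀

theorem4 : (∃[ c ] (1 ≤ c × (∀ N → ∃[ n ] (N ≤ n × ∃[ s ] (length s ≡ n × n ^ 5 ≤ c * (lzdTime s ^ 4 * ⌊log₂ n ⌋))))))
    × (∃[ c ] (1 ≤ c × (∀ N → ∃[ n ] (N ≤ n × ∃[ s ] (length s ≡ n × n ^ 5 ≤ c * (lzmwTime s ^ 4 * ⌊log₂ n ⌋))))))
theorem4 = superlinear lzd , superlinear lzmw
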